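{- For every graph $G$ we have $p(G)\leq a(G)\leq \mathrm{sa}_\ell(G)\leq p(G)+1$, and each of these three inequalities is strict for some graph. Moreover, $\mathrm{sa}_\ell(G)=p(G)$ if and only if $G$ has an orientation whose maximum out-degree is $p(G)$ and in which out-degree $p(G)$ is attained only at vertices of degree $p(G)$.
   Context: All graphs are finite and simple. A star forest is a forest each of whose components is a star (equivalently, a forest containing no path with 3 edges). The arboricity $a(G)$ is the minimum number of forests whose union is $E(G)$. A pseudoforest is a graph with at most one cycle in each component; the pseudoarboricity $p(G)$ is the minimum number of pseudoforests whose union is $E(G)$. The local star arboricity $\mathrm{sa}_\ell(G)$ is the minimum, over all families of star forests $S_1,\dots,S_k$ that are subgraphs of $G$ and whose edge sets together cover $E(G)$ (with $k$ arbitrary), of the maximum over vertices $v$ of $G$ of the number of indices $i$ with $v\in V(S_i)$. Equivalently, $\mathrm{sa}_\ell(G)=c_\ell^{\mathcal S}(G)$, the minimum over edge-surjective homomorphisms $\varphi$ from a disjoint union of star forests to $G$ that are injective on each star forest, of $\max_v|\varphi^{ -1}(v)|$. -}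

module Defs where

open import Data.Nat using (ℕ; zero; suc; _+_; _≤_; _<_)
open import Data.Fin using (Fin; zero; suc; inject₁; fromℕ)
open import Data.Bool using (Bool; true; false; T; _∨_; if_then_else_)
open import Data.Product using (Σ; ∃; _×_; _,_)
open import Data.Sum using (_⊎_)
open import Relation.Nullary using (¬_)
open import Relation.Binary.PropositionalEquality using (_≡_)
open import Function.Definitions using (Injective)

countF : ∀ {n} → (Fin n → Bool) → ℕ
countF {zero}  f = 0
countF {suc n} f = (if f zero then 1 else 0) + countF (λ i → f (suc i))

anyF : ∀ {n} → (Fin n → Bool) → Bool
anyF {zero}  f = false
anyF {suc n} f = f zero ∨ anyF (λ i → f (suc i))

record Graph (n : ℕ) : Set where
  field
    adj    : Fin n → Fin n → Bool
    sym    : ∀ u v → adj u v ≡ adj v u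
    irrefl : ∀ v → adj v v ≡ false
open Graph public

deg : ∀ {n} → Graph n → Fin n → ℕ
deg G v = countF (adj G v)

-- A spanning subgraph of G (given by its edge set; its vertices are
-- the endpoints of its edges, see vert below)
record Sub {n : ℕ} (G : Graph n) : Set where
  field
    sadj  : Fin n → Fin n → Bool
    ssym  : ∀ u v → sadj u v ≡ sadj v u
    inG   : ∀ u v → T (sadj u v) → T (adj G u v)
open Sub public

vert : ∀ {n} {G : Graph n} → Sub G → Fin n → Bool
vert S v = anyF (sadj S v)

record Cycle {n : ℕ} (E : Fin n → Fin n → Bool) : Set where
  field
    len   : ℕ
    len≥2 : 2 ≤ len
    vtx   : Fin (suc len) → Fin n
    inj   : Injective _≡_ _≡_ vtx
    step  : ∀ (i : Fin len) → T (E (vtx (inject₁ i)) (vtx (suc i)))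
    close : T (E (vtx (fromℕ len)) (vtx zero))
open Cycle public

CycleEdge : ∀ {n} {E : Fin n → Fin n → Bool} → Cycle E → Fin n → Fin n → Set
CycleEdge C u v =
  (Σ (Fin (len C)) λ i →
       (vtx C (inject₁ i) ≡ u × vtx C (suc i) ≡ v)
     ⊎ (vtx C (inject₁ i) ≡ v × vtx C (suc i) ≡ u))
  ⊎ ((vtx C (fromℕ (len C)) ≡ u × vtx C zero ≡ v)
     ⊎ (vtx C (fromℕ (len C)) ≡ v × vtx C zero ≡ u))

SameCycle : ∀ {n} {E : Fin n → Fin n → Bool} → Cycle E → Cycle E → Set
SameCycle {n} C D = ∀ (u v : Fin n) →
  (CycleEdge C u v → CycleEdge D u v) × (CycleEdge D u v → CycleEdge C u v)

data Reach {n : ℕ} (E : Fin n → Fin n → Bool) : Fin n → Fin n → Set where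
  here : ∀ {u} → Reach E u u
  next : ∀ {u v w} → T (E u v) → Reach E v w → Reach E u w

IsForest : ∀ {n} → (Fin n → Fin n → Bool) → Set
IsForest E = ¬ Cycle E

IsStarForest : ∀ {n} → (Fin n → Fin n → Bool) → Set
IsStarForest {n} E = IsForest E ×
  ¬ (Σ (Fin n) λ a → Σ (Fin n) λ b → Σ (Fin n) λ c → Σ (Fin n) λ d →
       ¬ a ≡ b × ¬ a ≡ c × ¬ a ≡ d × ¬ b ≡ c × ¬ b ≡ d × ¬ c ≡ d ×
       T (E a b) × T (E b c) × T (E c d))

IsPseudoforest : ∀ {n} → (Fin n → Fin n → Bool) → Set
IsPseudoforest E = ∀ (C D : Cycle E) →
  Reach E (vtx C zero) (vtx D zero) → SameCycle C D

CoverBy : ∀ {n} → ((Fin n → Fin n → Bool) → Set) → Graph n → ℕ → Set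
CoverBy {n} P G k = Σ (Fin k → Sub G) λ H →
  (∀ i → P (sadj (H i))) ×
  (∀ (u v : Fin n) → T (adj G u v) → Σ (Fin k) λ i → T (sadj (H i) u v))

IsArboricity : ∀ {n} → Graph n → ℕ → Set
IsArboricity G a = CoverBy IsForest G a × (∀ k → CoverBy IsForest G k → a ≤ k)

IsPseudoarboricity : ∀ {n} → Graph n → ℕ → Set
IsPseudoarboricity G p =
  CoverBy IsPseudoforest G p × (∀ k → CoverBy IsPseudoforest G k → p ≤ k)

LocalStarCover : ∀ {n} → Graph n → ℕ → Set
LocalStarCover {n} G s = Σ ℕ λ k → Σ (Fin k → Sub G) λ S →
  (∀ i → IsStarForest (sadj (S i))) ×
  (∀ (u v : Fin n) → T (adj G u v) → Σ (Fin k) λ i → T (sadj (S i) u v)) ×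
  (∀ (v : Fin n) → countF (λ i → vert (S i) v) ≤ s)

IsLocalStarArboricity : ∀ {n} → Graph n → ℕ → Set
IsLocalStarArboricity G s =
  LocalStarCover G s × (∀ t → LocalStarCover G t → s ≤ t)

record Orientation {n : ℕ} (G : Graph n) : Set where
  field
    out     : Fin n → Fin n → Bool     -- out u v : edge uv oriented u → v
    outInG  : ∀ u v → T (out u v) → T (adj G u v)
    total   : ∀ u v → T (adj G u v) → T (out u v) ⊎ T (out v u)
    antisym : ∀ u v → T (out u v) → ¬ T (out v u)
open Orientation public

outdeg : ∀ {n} {G : Graph n} → Orientation G → Fin n → ℕ
outdeg o v = countF (out o v)

-- the maximum out-degree of o equals d (max over the empty set is 0)
MaxOutdegIs : ∀ {n} {G : Graph n} → Orientation G → ℕ → Set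
MaxOutdegIs {n} o d = (∀ v → outdeg o v ≤ d) × (d ≡ 0 ⊎ Σ (Fin n) λ v → outdeg o v ≡ d)

{-# OPTIONS --safe #-}

-- A graph has pseudoarboricity at most k iff it has an orientation with out-degrees at most k.
-- Given such an orientation, the stars formed by the edges entering each vertex meet every v at
-- most outdeg v times as a leaf and at most once as a centre, the latter only if v has an
-- in-edge. Conversely, orient the edges of a local star cover from leaf to centre: v has at most
-- one out-edge in each star forest containing it, and when all these forests provide one, v is a
-- leaf in all of them and has no in-edge. This gives the equality criterion and sa ≤ p + 1.
--
-- For a ≤ sa, a family of star forests meeting each vertex at most s times has at most
-- s (|U| − 1) edges inside any nonempty vertex set U, so s forests suffice by the theorem of
-- Nash-Williams, proved here by exchanging edges along an uncoloured edge. That proof is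
-- classical, which is harmless because the inequalities between natural numbers are decidable.
module Submission where

open import Defs
open import Data.Nat using (ℕ; suc; _≤_; _<_; _+_)
open import Data.Product using (Σ; _×_)
open import Relation.Binary.PropositionalEquality using (_≡_)
open import Function.Bundles using (_⇔_)

open import Data.Bool using (Bool; true; false; T; _∧_; _∨_; not; if_then_else_)
open import Data.Bool.Properties as Boolₚ using (T?; T-irrelevant; ∧-identityʳ)
open import Data.Empty using (⊥; ⊥-elim)
open import Data.Fin as Fin using (Fin; zero; suc; inject₁; fromℕ; toℕ)
import Data.Fin.Properties as Finₚ
open import Data.Fin.Induction using (<-weakInduction; >-weakInduction; <-wellFounded)
open import Data.List as List using (List; []; _∷_; length)
open import Data.List.Membership.Propositional using (_∈_)
import Data.List.Membership.Propositional.Properties as ∈ₚ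
import Data.List.Relation.Unary.All as All
open import Data.List.Relation.Unary.AllPairs using (_∷_)
import Data.List.Relation.Unary.Any as Any
open import Data.List.Relation.Unary.Any.Properties using (lookup-index)
open import Data.List.Relation.Unary.Unique.Propositional using (Unique)
import Data.List.Relation.Unary.Unique.Propositional.Properties as Uniqueₚ
open import Data.Maybe using (Maybe; just; nothing)
open import Data.Maybe.Properties using (just-injective; ≡-dec)
open import Data.Nat using (zero; z≤n; s≤s; _*_; _∸_; NonZero; >-nonZero)
import Data.Nat.Properties as ℕₚ
open import Data.Product using (∃; _,_; proj₁; proj₂)
open import Data.Product.Properties using (,-injective)
open import Data.Sum as Sum using (_⊎_; inj₁; inj₂; [_,_]′)
open import Data.Unit using (tt)
open import Function using (_∘_; id; case_of_)
open import Function.Bundles using (mk⇔)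
open import Induction.WellFounded using (Acc; acc)
open import Relation.Binary using (tri<; tri≈; tri>)
open import Relation.Binary.Construct.Closure.ReflexiveTransitive using (Star; ε; _◅_; _◅◅_)
open import Relation.Binary.PropositionalEquality
  using (_≢_; refl; trans; cong; cong₂; subst; subst₂) renaming (sym to ≡-sym)
open import Relation.Nullary using (¬_; Dec; yes; no; does)
open import Relation.Nullary.Decidable using (does-⇔; from-yes; _→-dec_;
  decidable-stable; map′; _×-dec_; _⊎-dec_; ¬?; ¬¬-excluded-middle)
open import Algebra.Properties.CommutativeMonoid.Sum ℕₚ.+-0-commutativeMonoid
  using (sum; sum-cong-≗; ∑-distrib-+; ∑-comm)

-- Counting

-- A local cover may use more than `s` star forests, and nothing assigns them directly to `s`
-- forests; only their edge counts are used, hence the detour through a partition theorem. There an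
-- uncoloured edge is stuck when every colour already connects its ends. An exchange passes the lack
-- of colour on to an edge separating these ends within one colour, so the components of the colours
-- survive. Suppose that all states reached in this way are stuck, and let `U` be the component of
-- the original edge formed by the edges that can become uncoloured. Every colour then connects `U`,
-- hence has at least |U| - 1 edges inside it, and the uncoloured edge is one too many for
-- sparseness. The reachable states are never enumerated; this is where classical reasoning enters.
-- Star forests and pseudoforests are handled through one interface, an orientation with at most one
-- out-edge per vertex.

and⁺ : ∀ {a b} → T a → T b → T (a ∧ b)
and⁺ {true} _ q = q

and⁻ : ∀ {a b} → T (a ∧ b) → T a × T b
and⁻ {true} q = tt , q

dec⁺ : ∀ {A : Set} (d : Dec A) → A → T (does d)
dec⁺ (yes _) _ = tt
dec⁺ (no ¬a) a = ¬a a

dec⁻ : ∀ {A : Set} (d : Dec A) → T (does d) → A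
dec⁻ (yes a) _ = a

notDec⁺ : ∀ {A : Set} (d : Dec A) → ¬ A → T (not (does d))
notDec⁺ (yes a) ¬a = ¬a a
notDec⁺ (no _)  _  = tt

notDec⁻ : ∀ {A : Set} (d : Dec A) → T (not (does d)) → ¬ A
notDec⁻ (no ¬a) _ = ¬a

anyF⁺ : ∀ {n} (f : Fin n → Bool) i → T (f i) → T (anyF f)
anyF⁺ f zero    p with true ← f zero = tt
anyF⁺ f (suc i) p with f zero
... | true  = tt
... | false = anyF⁺ (f ∘ suc) i p

anyF⁻ : ∀ {n} (f : Fin n → Bool) → T (anyF f) → ∃ λ i → T (f i)
anyF⁻ {suc n} f p with f zero in eq
... | true  = zero , subst T (≡-sym eq) tt
... | false = let i , q = anyF⁻ (f ∘ suc) p in suc i , q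

countF-cong : ∀ {n} {f g : Fin n → Bool} → (∀ i → f i ≡ g i) → countF f ≡ countF g
countF-cong {zero}  e = refl
countF-cong {suc n} e = cong₂ (λ b c → (if b then 1 else 0) + c) (e zero) (countF-cong (e ∘ suc))

_∖ᵇ_ : ∀ {n} → (Fin n → Bool) → Fin n → Fin n → Bool
(f ∖ᵇ j) i = f i ∧ not (does (i Fin.≟ j))

countF-remove : ∀ {n} (f : Fin n → Bool) j → T (f j) → countF f ≡ suc (countF (f ∖ᵇ j))
countF-remove f zero p with true ← f zero =
  cong suc (countF-cong (λ i → ≡-sym (∧-identityʳ (f (suc i)))))
countF-remove f (suc j) p =
  trans (cong₂ (λ b c → (if b then 1 else 0) + c) (≡-sym (∧-identityʳ (f zero)))
               (countF-remove (f ∘ suc) j p))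
        (ℕₚ.+-suc _ _)

-- The map is required only on the support of `f`: labels of out-edges, for instance, exist for
-- out-edges alone.
countF-inj : ∀ {a b} (f : Fin a → Bool) (h : Fin b → Bool) (g : ∀ i → T (f i) → Fin b) →
  (∀ i p → T (h (g i p))) → (∀ i j p q → g i p ≡ g j q → i ≡ j) → countF f ≤ countF h
countF-inj {zero}  f h g into g-inj = z≤n
countF-inj {suc a} f h g into g-inj with f zero in eq
... | false = countF-inj (f ∘ suc) h (g ∘ suc) (into ∘ suc)
                (λ i j p q e → Finₚ.suc-injective (g-inj _ _ p q e))
... | true = subst (suc (countF (f ∘ suc)) ≤_) (≡-sym (countF-remove h (g zero p₀) (into zero p₀)))
    (s≤s (countF-inj (f ∘ suc) (h ∖ᵇ g zero p₀) (g ∘ suc)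
      (λ i p → and⁺ (into (suc i) p)
        (notDec⁺ (g (suc i) p Fin.≟ g zero p₀) λ e → case g-inj _ _ p p₀ e of λ ()))
      (λ i j p q e → Finₚ.suc-injective (g-inj _ _ p q e))))
  where p₀ = subst T (≡-sym eq) tt

countF-mono : ∀ {n} (f g : Fin n → Bool) → (∀ i → T (f i) → T (g i)) → countF f ≤ countF g
countF-mono f g f⊆g = countF-inj f g (λ i _ → i) f⊆g (λ _ _ _ _ e → e)

countF-all : ∀ n → countF {n} (λ _ → true) ≡ n
countF-all zero    = refl
countF-all (suc n) = cong suc (countF-all n)

countF≤n : ∀ {n} (f : Fin n → Bool) → countF f ≤ n
countF≤n f = subst (countF f ≤_) (countF-all _) (countF-mono f _ (λ _ _ → tt))

countF≥1 : ∀ {n} (f : Fin n → Bool) i → T (f i) → 1 ≤ countF f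
countF≥1 f i p = subst (1 ≤_) (≡-sym (countF-remove f i p)) (s≤s z≤n)

countF≤1 : ∀ {n} (f : Fin n → Bool) → (∀ i j → T (f i) → T (f j) → i ≡ j) → countF f ≤ 1
countF≤1 f u = countF-inj f (λ (_ : Fin 1) → true) (λ _ _ → zero) (λ _ _ → tt) (λ i j p q _ → u i j p q)

countF≤1⇒unique : ∀ {n} (f : Fin n → Bool) → countF f ≤ 1 → ∀ i j → T (f i) → T (f j) → i ≡ j
countF≤1⇒unique f ≤1 i j p q = decidable-stable (i Fin.≟ j) λ i≢j →
  ℕₚ.<⇒≱ (countF≥1 (f ∖ᵇ j) i (and⁺ p (notDec⁺ (i Fin.≟ j) i≢j)))
    (ℕₚ.≤-pred (subst (_≤ 1) (countF-remove f j q) ≤1))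

countF-witness : ∀ {n} (f : Fin n → Bool) → 1 ≤ countF f → ∃ λ i → T (f i)
countF-witness {suc n} f 1≤ with f zero in eq
... | true  = zero , subst T (≡-sym eq) tt
... | false = let i , p = countF-witness (f ∘ suc) 1≤ in suc i , p

-- A missed `j` could be removed from `h`, leaving too little room for the injection. This turns
-- equality of two counts into a statement about every neighbour or every star forest at a vertex.
countF-onto : ∀ {a b} (f : Fin a → Bool) (h : Fin b → Bool) (g : ∀ i → T (f i) → Fin b) →
  (∀ i p → T (h (g i p))) → (∀ i j p q → g i p ≡ g j q → i ≡ j) → countF h ≤ countF f →
  ∀ j → T (h j) → ∃ λ i → Σ (T (f i)) λ p → g i p ≡ j
countF-onto f h g into g-inj h≤f j q with Finₚ.any? (λ i → hit? i)
  where
  hit? : ∀ i → Dec (Σ (T (f i)) λ p → g i p ≡ j)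
  hit? i with T? (f i)
  ... | no ¬p = no λ (p , _) → ¬p p
  ... | yes p = map′ (p ,_) (λ (p′ , e) → trans (cong (g i) (T-irr (f i) p p′)) e) (g i p Fin.≟ j)
    where
    T-irr : ∀ b (p q : T b) → p ≡ q
    T-irr true _ _ = refl
... | yes found = found
... | no ¬found = ⊥-elim (ℕₚ.<⇒≱ (subst (suc (countF f) ≤_) (≡-sym (countF-remove h j q))
    (s≤s (countF-inj f (h ∖ᵇ j) g
      (λ i p → and⁺ (into i p) (notDec⁺ (g i p Fin.≟ j) λ e → ¬found (i , p , e))) g-inj))) h≤f)

countF≤length : ∀ {n} (U : Fin n → Bool) rs → (∀ u → T (U u) → u ∈ rs) → countF U ≤ length rs
countF≤length U [] sub = ℕₚ.≮⇒≥ λ 1≤ → case sub _ (proj₂ (countF-witness U 1≤)) of λ ()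
countF≤length U (r ∷ rs) sub with T? (U r)
... | yes p = subst (_≤ suc (length rs)) (≡-sym (countF-remove U r p))
    (s≤s (countF≤length (U ∖ᵇ r) rs λ u q → let q₁ , q₂ = and⁻ q in
      case sub u q₁ of λ { (Any.here refl) → ⊥-elim (notDec⁻ (u Fin.≟ u) q₂ refl) ; (Any.there m) → m }))
... | no ¬p = ℕₚ.m≤n⇒m≤1+n (countF≤length U rs λ u q →
      case sub u q of λ { (Any.here refl) → ⊥-elim (¬p q) ; (Any.there m) → m })

elements : ∀ {n} → (Fin n → Bool) → List (Fin n)
elements f = List.filter (λ i → T? (f i)) (List.allFin _)

length-elements : ∀ {n} (f : Fin n → Bool) → length (elements f) ≡ countF f
length-elements {n} f = go id
  where
  go : ∀ {k} (g : Fin k → Fin n) → length (List.filter (λ i → T? (f i)) (List.tabulate g)) ≡ countF (f ∘ g)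
  go {zero}  g = refl
  go {suc k} g with f (g zero)
  ... | true  = cong suc (go (g ∘ suc))
  ... | false = go (g ∘ suc)

𝟙 : Bool → ℕ
𝟙 b = if b then 1 else 0

countF≡sum : ∀ {n} (f : Fin n → Bool) → countF f ≡ sum (𝟙 ∘ f)
countF≡sum {zero}  f = refl
countF≡sum {suc n} f = cong (𝟙 (f zero) +_) (countF≡sum (f ∘ suc))

𝟙≤ : ∀ b {k} → (T b → 1 ≤ k) → 𝟙 b ≤ k
𝟙≤ true  h = h tt
𝟙≤ false h = z≤n

≤𝟙 : ∀ b {k} → k ≤ 1 → (1 ≤ k → T b) → k ≤ 𝟙 b
≤𝟙 true  k≤1 h = k≤1
≤𝟙 false {zero}  k≤1 h = z≤n
≤𝟙 false {suc k} k≤1 h = ⊥-elim (h (s≤s z≤n))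

sum-mono : ∀ {n} {f g : Fin n → ℕ} → (∀ i → f i ≤ g i) → sum f ≤ sum g
sum-mono {zero}  h = z≤n
sum-mono {suc n} h = ℕₚ.+-mono-≤ (h zero) (sum-mono (h ∘ suc))

sum-const : ∀ n k → sum {n} (λ _ → k) ≡ n * k
sum-const zero    k = refl
sum-const (suc n) k = cong (k +_) (sum-const n k)

sum-*ʳ : ∀ {n} (f : Fin n → ℕ) k → sum (λ i → f i * k) ≡ sum f * k
sum-*ʳ {zero}  f k = refl
sum-*ʳ {suc n} f k = trans (cong (f zero * k +_) (sum-*ʳ (f ∘ suc) k)) (≡-sym (ℕₚ.*-distribʳ-+ k (f zero) _))

sum-countF-swap : ∀ {a b} (P : Fin a → Fin b → Bool) →
  sum (λ i → countF (P i)) ≡ sum (λ j → countF (λ i → P i j))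
sum-countF-swap P = trans (sum-cong-≗ (λ i → countF≡sum (P i)))
  (trans (∑-comm (λ i j → 𝟙 (P i j))) (sum-cong-≗ (λ j → ≡-sym (countF≡sum (λ i → P i j)))))

countF-cover : ∀ {a b} (Q : Fin b → Bool) (P : Fin a → Fin b → Bool) →
  (∀ e → T (Q e) → ∃ λ i → T (P i e)) → countF Q ≤ sum (λ i → countF (P i))
countF-cover Q P cov = subst₂ _≤_ (≡-sym (countF≡sum Q)) (≡-sym (sum-countF-swap P))
  (sum-mono λ e → 𝟙≤ (Q e) λ q → let i , p = cov e q in countF≥1 (λ i → P i e) i p)

countF-disjoint : ∀ {a b} (Q : Fin b → Bool) (P : Fin a → Fin b → Bool) →
  (∀ i e → T (P i e) → T (Q e)) → (∀ i j e → T (P i e) → T (P j e) → i ≡ j) →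
  sum (λ i → countF (P i)) ≤ countF Q
countF-disjoint Q P P⊆Q disj = subst₂ _≤_ (≡-sym (sum-countF-swap P)) (≡-sym (countF≡sum Q))
  (sum-mono λ e → ≤𝟙 (Q e) (countF≤1 (λ i → P i e) (λ i j → disj i j e))
    λ 1≤ → let i , p = countF-witness (λ i → P i e) 1≤ in P⊆Q i e p)

-- Lets a set of edges be treated as decidable inside a proof of a negation.
¬¬-∀Fin : ∀ {n} {A : Fin n → Set} → (∀ i → ¬ ¬ A i) → ¬ ¬ (∀ i → A i)
¬¬-∀Fin {zero}  h k = k λ ()
¬¬-∀Fin {suc n} h k = h zero λ a → ¬¬-∀Fin (h ∘ suc) λ as → k λ { zero → a ; (suc i) → as i }

-- Makes the choice uniform without deciding `A` or `B`. It tells `countF-connected` whether some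
-- vertex relies on the edge being dropped.
all⊎any : ∀ {n} (U : Fin n → Bool) {A B : Fin n → Set} → (∀ u → T (U u) → A u ⊎ B u) →
  (∀ u → T (U u) → A u) ⊎ ∃ λ u → B u
all⊎any {zero}  U f = inj₁ λ ()
all⊎any {suc n} U {A} {B} f with all⊎any (U ∘ suc) (f ∘ suc)
... | inj₂ (u , b) = inj₂ (suc u , b)
... | inj₁ as with T? (U zero)
...   | no ¬p = inj₁ λ { zero p → ⊥-elim (¬p p) ; (suc u) p → as u p }
...   | yes p with f zero p
...     | inj₂ b = inj₂ (zero , b)
...     | inj₁ a = inj₁ λ { zero _ → a ; (suc u) p → as u p }

-- Connectivity along a set of edges

module Edges {n m : ℕ} (src tgt : Fin m → Fin n) where

  Joins : Fin m → Fin n → Fin n → Set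
  Joins e u v = (src e ≡ u × tgt e ≡ v) ⊎ (src e ≡ v × tgt e ≡ u)

  Joins-sym : ∀ {e u v} → Joins e u v → Joins e v u
  Joins-sym (inj₁ p) = inj₂ p
  Joins-sym (inj₂ p) = inj₁ p

  Joins-ends : ∀ {e u v x y} → Joins e u v → Joins e x y → (u ≡ x × v ≡ y) ⊎ (u ≡ y × v ≡ x)
  Joins-ends (inj₁ (refl , refl)) (inj₁ (refl , refl)) = inj₁ (refl , refl)
  Joins-ends (inj₁ (refl , refl)) (inj₂ (refl , refl)) = inj₂ (refl , refl)
  Joins-ends (inj₂ (refl , refl)) (inj₁ (refl , refl)) = inj₂ (refl , refl)
  Joins-ends (inj₂ (refl , refl)) (inj₂ (refl , refl)) = inj₁ (refl , refl)

  EdgeSet : Set₁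
  EdgeSet = Fin m → Set

  _⊆_ : EdgeSet → EdgeSet → Set
  P ⊆ Q = ∀ e → P e → Q e

  _∖_ : EdgeSet → Fin m → EdgeSet
  (P ∖ f) e = P e × e ≢ f

  data Conn (P : EdgeSet) : Fin n → Fin n → Set where
    ε   : ∀ {u} → Conn P u u
    via : ∀ {u v w} e → P e → Joins e u v → Conn P v w → Conn P u w

  private variable
    P Q : EdgeSet
    a b d : Fin n

  Conn-edge : ∀ e → P e → Joins e a b → Conn P a b
  Conn-edge e p j = via e p j ε

  Conn-trans : Conn P a b → Conn P b d → Conn P a d
  Conn-trans ε             q = q
  Conn-trans (via e p j r) q = via e p j (Conn-trans r q)

  Conn-sym : Conn P a b → Conn P b a
  Conn-sym ε             = ε
  Conn-sym (via e p j r) = Conn-trans (Conn-sym r) (Conn-edge e p (Joins-sym j))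

  Conn-mono : P ⊆ Q → Conn P a b → Conn Q a b
  Conn-mono P⊆Q ε             = ε
  Conn-mono P⊆Q (via e p j r) = via e (P⊆Q e p) j (Conn-mono P⊆Q r)

  Conn-joins : ∀ {e} → Joins e a b → Conn P (src e) (tgt e) → Conn P a b
  Conn-joins (inj₁ (refl , refl)) r = r
  Conn-joins (inj₂ (refl , refl)) r = Conn-sym r

  Conn-joins⁻ : ∀ {e} → Joins e a b → Conn P a b → Conn P (src e) (tgt e)
  Conn-joins⁻ (inj₁ (refl , refl)) r = r
  Conn-joins⁻ (inj₂ (refl , refl)) r = Conn-sym r

  Conn-bind : (∀ e → P e → Conn Q (src e) (tgt e)) → Conn P a b → Conn Q a b
  Conn-bind f ε             = ε
  Conn-bind f (via e p j r) = Conn-trans (Conn-joins j (f e p)) (Conn-bind f r)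

  Through : EdgeSet → Fin m → Fin n → Fin n → Set
  Through Q z a b = Σ (Fin n) λ x → Σ (Fin n) λ y → Joins z x y × Conn Q a x × Conn Q y b

  -- Several passages through `z` reduce to at most one: two in the same direction are merged by
  -- omitting what lies between them, and two in opposite directions cancel.
  Conn-split : ∀ z → (∀ e → P e → e ≡ z ⊎ Q e) → Conn P a b → Conn Q a b ⊎ Through Q z a b
  Conn-split z P⊆ ε = inj₁ ε
  Conn-split z P⊆ (via e p j r) with P⊆ e p | Conn-split z P⊆ r
  ... | inj₂ q    | inj₁ r′                     = inj₁ (via e q j r′)
  ... | inj₂ q    | inj₂ (x , y , k , r₁ , r₂) = inj₂ (x , y , k , via e q j r₁ , r₂)
  ... | inj₁ refl | inj₁ r′                     = inj₂ (_ , _ , j , ε , r′)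
  ... | inj₁ refl | inj₂ (x , y , k , r₁ , r₂) with Joins-ends j k
  ...   | inj₁ (refl , refl) = inj₂ (_ , _ , j , ε , r₂)
  ...   | inj₂ (refl , refl) = inj₁ r₂

  -- Every edge is a bridge. Loops and parallel edges count as cycles.
  Acyclic : EdgeSet → Set
  Acyclic P = ∀ e → P e → ¬ Conn (P ∖ e) (src e) (tgt e)

  Acyclic-⊆ : P ⊆ Q → Acyclic Q → Acyclic P
  Acyclic-⊆ P⊆Q acQ e p r = acQ e (P⊆Q e p) (Conn-mono (λ e′ (q , ne) → P⊆Q e′ q , ne) r)

  -- A new cycle through an old edge `e` must use `z`, and only one passage is needed. The rest of
  -- the cycle, including `e`, then connects the ends of `z` within `Q`.
  Acyclic-insert : ∀ z → (∀ e → P e → e ≡ z ⊎ Q e) → Acyclic Q → ¬ Conn Q (src z) (tgt z) → Acyclic P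
  Acyclic-insert {P} {Q} z P⊆ acQ ¬zz e p r with e Fin.≟ z
  ... | yes refl = ¬zz (Conn-mono (λ e′ (p′ , ne) → [ ⊥-elim ∘ ne , id ]′ (P⊆ e′ p′)) r)
  ... | no e≢z with P⊆ e p
  ...   | inj₁ e≡z = e≢z e≡z
  ...   | inj₂ q with Conn-split {Q = Q ∖ e} z split r
    where
    split : ∀ e′ → (P ∖ e) e′ → e′ ≡ z ⊎ (Q ∖ e) e′
    split e′ (p′ , ne) = [ inj₁ , (λ q′ → inj₂ (q′ , ne)) ]′ (P⊆ e′ p′)
  ...     | inj₁ r′ = acQ e q r′
  ...     | inj₂ (x , y , k , r₁ , r₂) = ¬zz (Conn-joins⁻ k
              (Conn-trans (Conn-sym (Conn-mono (λ _ → proj₁) r₁))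
                (via e q (inj₁ (refl , refl)) (Conn-sym (Conn-mono (λ _ → proj₁) r₂)))))

  ∈-or : ∀ {x y : Fin m} {L} → x ∈ (y ∷ L) → x ≡ y ⊎ x ∈ L
  ∈-or (Any.here e)  = inj₁ e
  ∈-or (Any.there i) = inj₂ i

  Conn? : (∀ e → Dec (P e)) → ∀ a b → Dec (Conn P a b)
  Conn? {P} P? a b = map′ (Conn-mono λ _ → proj₁) (Conn-mono λ e p → p , ∈ₚ.∈-allFin e) (go (List.allFin m) a b)
    where
    go : ∀ L a b → Dec (Conn (λ e → P e × e ∈ L) a b)
    go [] a b with a Fin.≟ b
    ... | yes refl = yes ε
    ... | no a≢b   = no λ { ε → a≢b refl ; (via _ (_ , ()) _ _) }
    go (f ∷ L) a b with P? f
    ... | no ¬p = map′ (Conn-mono λ _ (p , i) → p , Any.there i)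
                       (Conn-mono λ e (p , i) → p , [ (λ { refl → ⊥-elim (¬p p) }) , id ]′ (∈-or i)) (go L a b)
    ... | yes p = map′ to from
            (go L a b ⊎-dec (go L a (src f) ×-dec go L (tgt f) b ⊎-dec go L a (tgt f) ×-dec go L (src f) b))
      where
      P′ = λ e → P e × e ∈ L
      up : ∀ {u v} → Conn P′ u v → Conn (λ e → P e × e ∈ (f ∷ L)) u v
      up = Conn-mono λ _ (q , i) → q , Any.there i
      to : Conn P′ a b ⊎ (Conn P′ a (src f) × Conn P′ (tgt f) b) ⊎ (Conn P′ a (tgt f) × Conn P′ (src f) b) → _
      to (inj₁ r)                = up r
      to (inj₂ (inj₁ (r₁ , r₂))) = Conn-trans (up r₁) (via f (p , Any.here refl) (inj₁ (refl , refl)) (up r₂))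
      to (inj₂ (inj₂ (r₁ , r₂))) = Conn-trans (up r₁) (via f (p , Any.here refl) (inj₂ (refl , refl)) (up r₂))
      from : Conn (λ e → P e × e ∈ (f ∷ L)) a b → _
      from r with Conn-split f (λ e (q , i) → [ inj₁ , (λ i′ → inj₂ (q , i′)) ]′ (∈-or i)) r
      ... | inj₁ r′ = inj₁ r′
      ... | inj₂ (_ , _ , inj₁ (refl , refl) , r₁ , r₂) = inj₂ (inj₁ (r₁ , r₂))
      ... | inj₂ (_ , _ , inj₂ (refl , refl) , r₁ , r₂) = inj₂ (inj₂ (r₁ , r₂))

  -- Paths in an acyclic set are unique, so an avoidable edge is not on them. The edges outside `R`
  -- are discarded one at a time: a passage through such an `f`, closed up by the connection that
  -- avoids `f`, would be a cycle through `f`.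
  Conn-shrink : ∀ {R : EdgeSet} {x y} → (∀ e → Dec (P e)) → (∀ e → Dec (R e)) → Acyclic P →
    (∀ f → P f → ¬ R f → Conn (P ∖ f) x y) → Conn P x y → Conn (λ e → P e × R e) x y
  Conn-shrink {P} {R} {x} {y} P? R? acP needed r =
    Conn-mono (λ e (p , h) → p , h (∈ₚ.∈-allFin e)) (go (List.allFin m))
    where
    P[_] : List (Fin m) → EdgeSet
    P[ L ] e = P e × (e ∈ L → R e)
    go : ∀ L → Conn P[ L ] x y
    go [] = Conn-mono (λ _ p → p , λ ()) r
    go (f ∷ L) with P? f | R? f
    ... | yes _ | yes ρ = Conn-mono (λ e (p , h) → p , [ (λ { refl → ρ }) , h ]′ ∘ ∈-or) (go L)
    ... | no ¬p | _     = Conn-mono (λ e (p , h) → p , [ (λ { refl → ⊥-elim (¬p p) }) , h ]′ ∘ ∈-or) (go L)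
    ... | yes pf | no ¬ρ with Conn-split {Q = P[ L ] ∖ f} f split (go L)
      where
      split : ∀ e → P[ L ] e → e ≡ f ⊎ (P[ L ] ∖ f) e
      split e q with e Fin.≟ f
      ... | yes e≡f = inj₁ e≡f
      ... | no  e≢f = inj₂ (q , e≢f)
    ...   | inj₁ r′ = Conn-mono (λ e ((p , h) , ne) → p , [ ⊥-elim ∘ ne , h ]′ ∘ ∈-or) r′
    ...   | inj₂ (_ , _ , k , r₁ , r₂) = ⊥-elim (acP f pf (Conn-joins⁻ k
              (Conn-trans (Conn-sym (down r₁)) (Conn-trans (needed f pf ¬ρ) (Conn-sym (down r₂))))))
      where
      down : ∀ {u v} → Conn (P[ L ] ∖ f) u v → Conn (P ∖ f) u v
      down = Conn-mono λ _ ((p , _) , ne) → p , ne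

  -- An edge merges at most two components, so dropping one costs at most one further
  -- representative. `reps` is general because the induction enlarges it.
  countF-connected : ∀ (U : Fin n → Bool) (L : List (Fin m)) (reps : List (Fin n)) →
    (∀ u → T (U u) → ∃ λ r → r ∈ reps × Conn (_∈ L) u r) → countF U ≤ length reps + length L
  countF-connected U [] reps h = subst (countF U ≤_) (≡-sym (ℕₚ.+-identityʳ _))
    (countF≤length U reps λ u p → case h u p of λ { (r , i , ε) → i ; (_ , _ , via _ () _ _) })
  countF-connected U (e ∷ L) reps h with all⊎any U split
    where
    split : ∀ u → T (U u) → (∃ λ r → r ∈ reps × Conn (_∈ L) u r) ⊎
                             (∃ λ r → r ∈ reps × Through (_∈ L) e u r)
    split u p = let r , i , c = h u p in
      [ (λ c′ → inj₁ (r , i , c′)) , (λ t → inj₂ (r , i , t)) ]′ (Conn-split e (λ _ → ∈-or) c)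
  ... | inj₁ h′ = ℕₚ.≤-trans (countF-connected U L reps h′) (ℕₚ.+-monoʳ-≤ (length reps) (ℕₚ.n≤1+n _))
  -- The other end `y₀` of the dropped edge reaches `r₀` without it, so only the side of `x₀` may
  -- lose its representative.
  ... | inj₂ (_ , r₀ , i₀ , x₀ , y₀ , j₀ , _ , c₀) = subst (countF U ≤_) (≡-sym (ℕₚ.+-suc _ _))
        (countF-connected U L (x₀ ∷ reps) h′)
    where
    h′ : ∀ u → T (U u) → ∃ λ r → r ∈ (x₀ ∷ reps) × Conn (_∈ L) u r
    h′ u p with h u p
    ... | r , i , c with Conn-split e (λ _ → ∈-or) c
    ...   | inj₁ c′ = r , Any.there i , c′
    ...   | inj₂ (x , y , j , c₁ , c₂) with Joins-ends j j₀
    ...     | inj₁ (refl , refl) = x₀ , Any.here refl , c₁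
    ...     | inj₂ (refl , refl) = r₀ , Any.there i₀ , Conn-trans c₁ c₀

-- Partition into forests

inside : ∀ {n m} (src tgt : Fin m → Fin n) → (Fin n → Bool) → Fin m → Bool
inside src tgt U e = U (src e) ∧ U (tgt e)

-- |E(U)| ≤ s (|U| − 1), without truncated subtraction.
Sparse : ∀ {n m} (src tgt : Fin m → Fin n) → ℕ → Set
Sparse {n} src tgt s = ∀ (U : Fin n → Bool) u → T (U u) → countF (inside src tgt U) + s ≤ s * countF U

module ForestPartition {n m : ℕ} (src tgt : Fin m → Fin n) (s : ℕ) (sparse : Sparse src tgt s) where
  open Edges src tgt

  Colouring : Set
  Colouring = Fin m → Maybe (Fin s)

  Class : Colouring → Fin s → EdgeSet
  Class c i e = c e ≡ just i

  Class? : ∀ c i e → Dec (Class c i e)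
  Class? c i e = ≡-dec Fin._≟_ (c e) (just i)

  Valid : Colouring → Set
  Valid c = ∀ i → Acyclic (Class c i)

  _[_↦_] : Colouring → Fin m → Maybe (Fin s) → Colouring
  (c [ z ↦ v ]) e with e Fin.≟ z
  ... | yes _ = v
  ... | no  _ = c e

  update-same : ∀ c z v → (c [ z ↦ v ]) z ≡ v
  update-same c z v with z Fin.≟ z
  ... | yes _  = refl
  ... | no z≢z = ⊥-elim (z≢z refl)

  update-other : ∀ c z v e → e ≢ z → (c [ z ↦ v ]) e ≡ c e
  update-other c z v e e≢z with e Fin.≟ z
  ... | yes e≡z = ⊥-elim (e≢z e≡z)
  ... | no _    = refl

  Class-update : ∀ c z v j e → Class (c [ z ↦ v ]) j e → (e ≡ z × v ≡ just j) ⊎ (e ≢ z × Class c j e)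
  Class-update c z v j e p with e Fin.≟ z
  ... | yes e≡z = inj₁ (e≡z , p)
  ... | no  e≢z = inj₂ (e≢z , p)

  Valid-colour : ∀ c z i → Valid c → ¬ Conn (Class c i) (src z) (tgt z) → Valid (c [ z ↦ just i ])
  Valid-colour c z i val ¬zz j with i Fin.≟ j
  ... | yes refl = Acyclic-insert z
          (λ e p → [ inj₁ ∘ proj₁ , inj₂ ∘ proj₂ ]′ (Class-update c z (just i) j e p)) (val i) ¬zz
  ... | no i≢j = Acyclic-⊆
          (λ e p → [ ⊥-elim ∘ i≢j ∘ just-injective ∘ proj₂ , proj₂ ]′ (Class-update c z (just i) j e p)) (val j)

  Class-uncolour : ∀ c f j e → Class (c [ f ↦ nothing ]) j e → (Class c j ∖ f) e
  Class-uncolour c f j e p with inj₂ (ne , q) ← Class-update c f nothing j e p = q , ne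

  exchange : Colouring → Fin m → Fin s → Fin m → Colouring
  exchange c z i f = (c [ f ↦ nothing ]) [ z ↦ just i ]

  -- (c , z): a partial colouring with a designated uncoloured edge. An exchange
  -- colours z with i and uncolours an edge f separating the ends of z in colour i;
  -- it preserves the components of every colour.
  data Reachable (c₀ : Colouring) (z₀ : Fin m) : Colouring → Fin m → Set where
    start : Reachable c₀ z₀ c₀ z₀
    swap  : ∀ {c z} i f → Reachable c₀ z₀ c z → Class c i f →
            ¬ Conn (Class c i ∖ f) (src z) (tgt z) → Reachable c₀ z₀ (exchange c z i f) f

  Coloured : Colouring → Fin m → Set
  Coloured c e = ∃ λ i → Class c i e

  module FromState (c₀ : Colouring) (z₀ : Fin m) (valid₀ : Valid c₀) (uncol₀ : c₀ z₀ ≡ nothing) where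

    uncoloured : ∀ {c z} → Reachable c₀ z₀ c z → c z ≡ nothing
    uncoloured start = uncol₀
    uncoloured (swap {c} {z} i f r cf _) = trans (update-other _ z _ f f≢z) (update-same c f nothing)
      where
      f≢z : f ≢ z
      f≢z refl = case trans (≡-sym cf) (uncoloured r) of λ ()

    valid : ∀ {c z} → Reachable c₀ z₀ c z → Valid c
    valid start = valid₀
    valid (swap {c} {z} i f r cf sep) = Valid-colour _ z i
      (λ j → Acyclic-⊆ (λ e → proj₁ ∘ Class-uncolour c f j e) (valid r j))
      (sep ∘ Conn-mono (Class-uncolour c f i))

    -- Exchanges only move the gap: no other edge loses its colour for good, so colouring the
    -- current `z` completes the extension.
    coloured : ∀ {c z} → Reachable c₀ z₀ c z → ∀ y → y ≡ z₀ ⊎ Coloured c₀ y → y ≡ z ⊎ Coloured c y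
    coloured start y h = h
    coloured (swap {c} {z} i f r cf sep) y h with y Fin.≟ f | y Fin.≟ z | coloured r y h
    ... | yes y≡f | _        | _              = inj₁ y≡f
    ... | no y≢f  | yes _    | _              = inj₂ (i , refl)
    ... | no y≢f  | no y≢z   | inj₁ y≡z       = ⊥-elim (y≢z y≡z)
    ... | no y≢f  | no y≢z   | inj₂ (j , p) = inj₂ (j , trans (update-other c f nothing y y≢f) p)

    R : EdgeSet
    R e = ∃ λ c → Reachable c₀ z₀ c e

    module Stuck (R? : ∀ e → Dec (R e))
      (stuck : ∀ {c z} → Reachable c₀ z₀ c z → ∀ i → Conn (Class c i) (src z) (tgt z)) where

      _∩R : EdgeSet → EdgeSet
      (P ∩R) e = P e × R e

      -- An edge of colour `i` separating the ends of `z` can be exchanged with `z`, so it belongs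
      -- to `R`. The edges outside `R` are therefore avoidable, and `Conn-shrink` removes them.
      stuck-R : ∀ {c z} → Reachable c₀ z₀ c z → ∀ i → Conn (Class c i ∩R) (src z) (tgt z)
      stuck-R {c} r i = Conn-shrink (Class? c i) R? (valid r i)
        (λ f cf ¬Rf → decidable-stable (Conn? (λ e → Class? c i e ×-dec ¬? (e Fin.≟ f)) _ _)
          λ sep → ¬Rf (_ , swap i f r cf sep))
        (stuck r i)

      -- Undo the exchanges one by one. The only edge gained by a colour is `z`, and before the
      -- exchange its ends were already connected in that colour within `R`.
      transport : ∀ {c z a b} → Reachable c₀ z₀ c z → ∀ j → Conn (Class c j ∩R) a b → Conn (Class c₀ j ∩R) a b
      transport start j p = p
      transport (swap {c} {z} i f r cf sep) j p = transport r j (Conn-bind old p)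
        where
        old : ∀ e → (Class (exchange c z i f) j ∩R) e → Conn (Class c j ∩R) (src e) (tgt e)
        old e (q , ρ) with Class-update (c [ f ↦ nothing ]) z (just i) j e q
        ... | inj₁ (refl , refl) = stuck-R r i
        ... | inj₂ (_ , q′)      =
          Conn-edge e (proj₁ (Class-uncolour c f j e q′) , ρ) (inj₁ (refl , refl))

      R-connects : ∀ e → R e → ∀ i → Conn (Class c₀ i ∩R) (src e) (tgt e)
      R-connects e (c , r) i = transport r i (stuck-R r i)

      x₀ : Fin n
      x₀ = src z₀

      -- The component of `z₀` under the edges of `R` is the vertex set that will violate `sparse`.
      U? : ∀ u → Dec (Conn R x₀ u)
      U? = Conn? R? x₀

      U : Fin n → Bool
      U u = does (U? u)

      I : Fin m → Bool
      I = inside src tgt U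

      class∩? : ∀ i e → Dec (Class c₀ i e × R e)
      class∩? i e = Class? c₀ i e ×-dec R? e

      treeᵇ : Fin s → Fin m → Bool
      treeᵇ i e = does (class∩? i e) ∧ I e

      I⁺ : ∀ {e u v} → Joins e u v → Conn R x₀ u → Conn R x₀ v → T (I e)
      I⁺ (inj₁ (refl , refl)) p q = and⁺ (dec⁺ (U? _) p) (dec⁺ (U? _) q)
      I⁺ (inj₂ (refl , refl)) p q = and⁺ (dec⁺ (U? _) q) (dec⁺ (U? _) p)

      Conn-tree : ∀ i {u v} → Conn R x₀ u → Conn (Class c₀ i ∩R) u v → Conn (_∈ elements (treeᵇ i)) u v
      Conn-tree i ru ε = ε
      Conn-tree i ru (via e p j r) = via e
        (∈ₚ.∈-filter⁺ _ (∈ₚ.∈-allFin e) (and⁺ (dec⁺ (class∩? i e) p) (I⁺ j ru rv))) j (Conn-tree i rv r)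
        where rv = Conn-trans ru (Conn-edge e (proj₂ p) j)

      -- `R` connects `U`, and each edge of `R` can be replaced by a walk of colour `i` in `R`,
      -- which stays in `U`. Connecting `U` takes at least |U| - 1 edges.
      tree-spans : ∀ i → countF U ≤ suc (countF (treeᵇ i))
      tree-spans i = subst (λ k → countF U ≤ suc k) (length-elements (treeᵇ i))
        (countF-connected U (elements (treeᵇ i)) (x₀ ∷ []) λ u p → x₀ , Any.here refl ,
          Conn-sym (Conn-tree i ε (Conn-bind (λ e ρ → R-connects e ρ i) (dec⁻ (U? u) p))))

      trees : ℕ
      trees = sum (λ i → countF (treeᵇ i))

      -- The extra one is `z₀`, which lies inside `U` but has no colour.
      trees-fit : suc trees ≤ countF I
      trees-fit = subst (suc trees ≤_) (≡-sym (countF-remove I z₀ I₀)) (s≤s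
        (countF-disjoint (I ∖ᵇ z₀) treeᵇ
          (λ i e p → let q₁ , q₂ = and⁻ {does (class∩? i e)} p in and⁺ q₂ (notDec⁺ (e Fin.≟ z₀)
            λ { refl → case trans (≡-sym uncol₀) (proj₁ (dec⁻ (class∩? i e) q₁)) of λ () }))
          λ i j e p q → just-injective (trans (≡-sym (colour i e p)) (colour j e q))))
        where
        I₀ : T (I z₀)
        I₀ = I⁺ (inj₁ (refl , refl)) ε (Conn-edge z₀ (_ , start) (inj₁ (refl , refl)))
        colour : ∀ i e → T (treeᵇ i e) → Class c₀ i e
        colour i e p = proj₁ (dec⁻ (class∩? i e) (proj₁ (and⁻ p)))

      contradiction : ⊥
      contradiction = ℕₚ.<-irrefl refl (begin-strict
        s * countF U                              ≡⟨ sum-const s (countF U) ⟨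
        sum {s} (λ _ → countF U)                  ≤⟨ sum-mono tree-spans ⟩
        sum (λ i → 1 + countF (treeᵇ i))          ≡⟨ ∑-distrib-+ {s} (λ _ → 1) _ ⟩
        sum {s} (λ _ → 1) + trees
                                                  ≡⟨ cong (_+ trees) (trans (sum-const s 1) (ℕₚ.*-identityʳ s)) ⟩
        s + trees          <⟨ ℕₚ.+-monoʳ-< s trees-fit ⟩
        s + countF I                              ≡⟨ ℕₚ.+-comm s _ ⟩
        countF I + s                              ≤⟨ sparse U x₀ (dec⁺ (U? x₀) ε) ⟩
        s * countF U                              ∎)
        where open ℕₚ.≤-Reasoning

  -- If some reachable state lets its uncoloured edge take a colour without closing a cycle, the
  -- colouring extends; otherwise all reachable states are stuck. The double negation permits this
  -- distinction although the states are not listed.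
  partial : ∀ L → ¬ ¬ (∃ λ c → Valid c × (∀ y → y ∈ L → Coloured c y))
  partial [] k = k ((λ _ → nothing) , (λ i e ()) , λ y ())
  partial (z ∷ L) k = partial L λ (c₀ , val₀ , col₀) → extend c₀ val₀ col₀ (c₀ z) refl
    where
    extend : ∀ c₀ → Valid c₀ → (∀ y → y ∈ L → Coloured c₀ y) → ∀ v → c₀ z ≡ v → ⊥
    extend c₀ val₀ col₀ (just i) eq = k (c₀ , val₀ , λ { y (Any.here refl) → i , eq ; y (Any.there m) → col₀ y m })
    extend c₀ val₀ col₀ nothing eq = ¬¬-∀Fin {A = λ e → Dec (FromState.R c₀ z val₀ eq e)} (λ _ → ¬¬-excluded-middle)
      λ R? → Stuck.contradiction R? stuck
      where
      open FromState c₀ z val₀ eq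
      stuck : ∀ {c z′} → Reachable c₀ z c z′ → ∀ i → Conn (Class c i) (src z′) (tgt z′)
      stuck {c} {z′} r i = decidable-stable (Conn? (Class? c i) _ _) λ ¬zz →
        k (c [ z′ ↦ just i ] , Valid-colour c z′ i (valid r) ¬zz , full)
        where
        full : ∀ y → y ∈ (z ∷ L) → Coloured (c [ z′ ↦ just i ]) y
        full y y∈ with y Fin.≟ z′ | coloured r y ([ inj₁ , inj₂ ∘ col₀ y ]′ (∈-or y∈))
        ... | yes _    | _ = i , refl
        ... | no y≢z′  | inj₁ y≡z′ = ⊥-elim (y≢z′ y≡z′)
        ... | no y≢z′  | inj₂ (j , p) = j , p

  forests : ¬ ¬ (Σ (Fin m → Fin s) λ c → ∀ i → Acyclic (λ e → c e ≡ i))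
  forests k = partial (List.allFin m) λ (c , val , col) →
    k ((λ e → proj₁ (col e (∈ₚ.∈-allFin e))) ,
       λ i → Acyclic-⊆ (λ { e refl → proj₂ (col e (∈ₚ.∈-allFin e)) }) (val i))

-- From indexed edges to graphs and back

cycle-free : ∀ {n m} (src tgt : Fin m → Fin n) → let open Edges src tgt in
  ∀ {E : Fin n → Fin n → Bool} {P} → Acyclic P →
  (∀ u v → T (E u v) → ∃ λ e → P e × Joins e u v) → IsForest E
cycle-free src tgt {P = P} acP edge C with edge _ _ (close C)
... | e , p , j = acP e p (Conn-joins⁻ j (Conn-sym (reach (fromℕ (len C)))))
  where
  open Edges src tgt
  reach : ∀ i → Conn (P ∖ e) (vtx C zero) (vtx C i)
  reach = <-weakInduction _ ε λ i r →
    let e′ , p′ , j′ = edge _ _ (Cycle.step C i)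
        e′≢e : e′ ≢ e
        e′≢e = λ { refl → case Joins-ends j′ j of λ where
          (inj₁ (_ , q)) → case inj C q of λ ()
          -- A step that repeats the closing edge backwards starts at index 0 and ends at the last
          -- index, so the cycle would have `len` equal to 1.
          (inj₂ (q₁ , q₂)) → ℕₚ.<⇒≢ (len≥2 C)
            (trans (cong suc (trans (≡-sym (cong toℕ (inj C q₁))) (Finₚ.toℕ-inject₁ i)))
              (trans (cong toℕ (inj C q₂)) (Finₚ.toℕ-fromℕ _))) }
    in Conn-trans r (Conn-edge e′ (p′ , e′≢e) j′)

lookup-injective : ∀ {A : Set} {xs : List A} → Unique xs → ∀ i j → List.lookup xs i ≡ List.lookup xs j → i ≡ j
lookup-injective (_ ∷ _)  zero    zero    e = refl
lookup-injective (x ∷ _)  zero    (suc j) e = ⊥-elim (All.lookup x (∈ₚ.∈-lookup j) e)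
lookup-injective (x ∷ _)  (suc i) zero    e = ⊥-elim (All.lookup x (∈ₚ.∈-lookup i) (≡-sym e))
lookup-injective (_ ∷ xs) (suc i) (suc j) e = cong suc (lookup-injective xs i j e)

module Enumerate {n : ℕ} (D : Fin n → Fin n → Bool) where

  pairs : List (Fin n × Fin n)
  pairs = List.cartesianProduct (List.allFin n) (List.allFin n)

  D? : (p : Fin n × Fin n) → Dec (T (D (proj₁ p) (proj₂ p)))
  D? p = T? (D (proj₁ p) (proj₂ p))

  edges : List (Fin n × Fin n)
  edges = List.filter D? pairs

  src tgt : Fin (length edges) → Fin n
  src e = proj₁ (List.lookup edges e)
  tgt e = proj₂ (List.lookup edges e)

  sound : ∀ e → T (D (src e) (tgt e))
  sound e = proj₂ (∈ₚ.∈-filter⁻ D? {xs = pairs} (∈ₚ.∈-lookup e))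

  complete : ∀ u v → T (D u v) → ∃ λ e → src e ≡ u × tgt e ≡ v
  complete u v d = Any.index uv∈ , ,-injective (≡-sym (lookup-index uv∈))
    where
    uv∈ : (u , v) ∈ edges
    uv∈ = ∈ₚ.∈-filter⁺ D? (∈ₚ.∈-cartesianProduct⁺ (∈ₚ.∈-allFin u) (∈ₚ.∈-allFin v)) d

  ends-injective : ∀ e e′ → src e ≡ src e′ → tgt e ≡ tgt e′ → e ≡ e′
  ends-injective e e′ p q = lookup-injective
    (Uniqueₚ.filter⁺ D? (Uniqueₚ.cartesianProduct⁺ (Uniqueₚ.allFin⁺ n) (Uniqueₚ.allFin⁺ n))) e e′ (cong₂ _,_ p q)

  open Edges src tgt public

  Joins? : ∀ e u v → Dec (Joins e u v)
  Joins? e u v = (src e Fin.≟ u ×-dec tgt e Fin.≟ v) ⊎-dec (src e Fin.≟ v ×-dec tgt e Fin.≟ u)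

-- Covers and orientations

adj-sym : ∀ {n} (G : Graph n) {u v} → T (adj G u v) → T (adj G v u)
adj-sym G {u} {v} = subst T (Graph.sym G u v)

adj⇒≢ : ∀ {n} (G : Graph n) {u v} → T (adj G u v) → u ≢ v
adj⇒≢ G {u} a refl = subst T (Graph.irrefl G u) a

Covers : ∀ {n k} (G : Graph n) → (Fin k → Sub G) → Set
Covers G H = ∀ u v → T (adj G u v) → ∃ λ i → T (sadj (H i) u v)

-- Each edge {u,v} gets one member of the cover, whichever way round the edge is given.
module Index {n k : ℕ} {G : Graph n} (H : Fin k → Sub G) (cov : Covers G H) where

  idx : ∀ u v → T (adj G u v) → Fin k
  idx u v a with Finₚ.<-cmp u v
  ... | tri< _ _ _ = proj₁ (cov u v a)
  ... | tri≈ _ _ _ = proj₁ (cov u v a)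
  ... | tri> _ _ _ = proj₁ (cov v u (adj-sym G a))

  idx-covers : ∀ u v a → T (sadj (H (idx u v a)) u v)
  idx-covers u v a with Finₚ.<-cmp u v
  ... | tri< _ _ _ = proj₂ (cov u v a)
  ... | tri≈ _ _ _ = proj₂ (cov u v a)
  ... | tri> _ _ _ = subst T (ssym (H _) v u) (proj₂ (cov v u (adj-sym G a)))

  idx-sym : ∀ u v a a′ → idx u v a ≡ idx v u a′
  idx-sym u v a a′ with Finₚ.<-cmp u v | Finₚ.<-cmp v u
  ... | tri< _ _ _   | tri> _ _ _   = cong (proj₁ ∘ cov u v) (T-irrelevant _ _)
  ... | tri> _ _ _   | tri< _ _ _   = cong (proj₁ ∘ cov v u) (T-irrelevant _ _)
  ... | tri≈ _ u≡v _ | _            = ⊥-elim (adj⇒≢ G a u≡v)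
  ... | _            | tri≈ _ v≡u _ = ⊥-elim (adj⇒≢ G a′ v≡u)
  ... | tri< _ _ ¬>  | tri< v<u _ _ = ⊥-elim (¬> v<u)
  ... | tri> ¬< _ _  | tri> _ _ u<v = ⊥-elim (¬< u<v)

-- An orientation in which every vertex has at most one out-edge, the form shared by star forests
-- and pseudoforests.
record Orients {n} (E o : Fin n → Fin n → Bool) : Set where
  field
    o⊆E        : ∀ u v → T (o u v) → T (E u v)
    o-total    : ∀ u v → T (E u v) → T (o u v) ⊎ T (o v u)
    o-asym     : ∀ u v → T (o u v) → ¬ T (o v u)
    functional : ∀ u v w → T (o u v) → T (o u w) → v ≡ w

module Combine {n k : ℕ} {G : Graph n} (H : Fin k → Sub G) (cov : Covers G H)
  (o : Fin k → Fin n → Fin n → Bool) (orients : ∀ i → Orients (sadj (H i)) (o i)) where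
  open Index {G = G} H cov public
  open module O i = Orients (orients i) public

  -- Members of the cover may overlap and orient a common edge differently; only the member chosen
  -- by `idx` decides.
  Out : Fin n → Fin n → Set
  Out u v = Σ (T (adj G u v)) λ a → T (o (idx u v a) u v)

  Out? : ∀ u v → Dec (Out u v)
  Out? u v with T? (adj G u v)
  ... | no ¬a = no (¬a ∘ proj₁)
  ... | yes a = map′ (a ,_) (λ (a′ , p) → subst (λ a → T (o (idx u v a) u v)) (T-irrelevant a′ a) p)
                  (T? (o (idx u v a) u v))

  orientation : Orientation G
  orientation = record
    { out     = λ u v → does (Out? u v)
    ; outInG  = λ u v → proj₁ ∘ dec⁻ (Out? u v)
    ; total   = λ u v a → [ (λ p → inj₁ (dec⁺ (Out? u v) (a , p)))
                          , (λ p → inj₂ (dec⁺ (Out? v u) (adj-sym G a ,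
                              subst (λ i → T (o i v u)) (idx-sym u v a (adj-sym G a)) p))) ]′
                          (o-total _ u v (idx-covers u v a))
    ; antisym = λ u v p q → let a , p′ = dec⁻ (Out? u v) p ; a′ , q′ = dec⁻ (Out? v u) q in
                  o-asym _ u v p′ (subst (λ i → T (o i v u)) (idx-sym v u a′ a) q′)
    }

  label : ∀ u v → T (out orientation u v) → Fin k
  label u v p = idx u v (proj₁ (dec⁻ (Out? u v) p))

  label-out : ∀ u v p → T (o (label u v p) u v)
  label-out u v p = proj₂ (dec⁻ (Out? u v) p)

  label-vert : ∀ u v p → T (vert (H (label u v p)) u)
  label-vert u v p = anyF⁺ (sadj (H _) u) v (o⊆E _ u v (label-out u v p))

  label-injective : ∀ u v w p q → label u v p ≡ label u w q → v ≡ w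
  label-injective u v w p q eq = functional _ u v w (label-out u v p)
    (subst (λ i → T (o i u w)) (≡-sym eq) (label-out u w q))

  outdeg≤vert : ∀ u → outdeg orientation u ≤ countF (λ i → vert (H i) u)
  outdeg≤vert u = countF-inj (out orientation u) (λ i → vert (H i) u) (label u) (label-vert u) (label-injective u)

-- Local star covers

triangle : ∀ {n} {E : Fin n → Fin n → Bool} {a b c} → a ≢ b → b ≢ c → a ≢ c →
  T (E a b) → T (E b c) → T (E c a) → Cycle E
triangle {n} {E} {a} {b} {c} a≢b b≢c a≢c ab bc ca = record
  { len = 2 ; len≥2 = s≤s (s≤s z≤n) ; vtx = v ; inj = v-inj _ _
  ; step = λ { zero → ab ; (suc zero) → bc } ; close = ca }
  where
  v : Fin 3 → Fin n
  v zero             = a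
  v (suc zero)       = b
  v (suc (suc zero)) = c
  v-inj : ∀ i j → v i ≡ v j → i ≡ j
  v-inj zero             zero             _ = refl
  v-inj zero             (suc zero)       e = ⊥-elim (a≢b e)
  v-inj zero             (suc (suc zero)) e = ⊥-elim (a≢c e)
  v-inj (suc zero)       zero             e = ⊥-elim (a≢b (≡-sym e))
  v-inj (suc zero)       (suc zero)       _ = refl
  v-inj (suc zero)       (suc (suc zero)) e = ⊥-elim (b≢c e)
  v-inj (suc (suc zero)) zero             e = ⊥-elim (a≢c (≡-sym e))
  v-inj (suc (suc zero)) (suc zero)       e = ⊥-elim (b≢c (≡-sym e))
  v-inj (suc (suc zero)) (suc (suc zero)) _ = refl

star : ∀ {n} {E : Fin n → Fin n → Bool} w → (∀ u v → T (E u v) → u ≡ w ⊎ v ≡ w) → IsStarForest E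
star w at-w = no-cycle , no-path
  where
  no-path : ¬ _
  no-path (a , b , c , d , _ , a≢c , a≢d , b≢c , b≢d , _ , ab , _ , cd) with at-w a b ab | at-w c d cd
  ... | inj₁ p | inj₁ q = a≢c (trans p (≡-sym q))
  ... | inj₁ p | inj₂ q = a≢d (trans p (≡-sym q))
  ... | inj₂ p | inj₁ q = b≢c (trans p (≡-sym q))
  ... | inj₂ p | inj₂ q = b≢d (trans p (≡-sym q))
  no-cycle : IsForest _
  no-cycle record { len≥2 = s≤s (s≤s _) ; inj = inj ; step = step ; close = close }
    with at-w _ _ (step zero) | at-w _ _ (step (suc zero)) | at-w _ _ close
  ... | inj₁ p | inj₁ q | _      = case inj (trans p (≡-sym q)) of λ ()
  ... | inj₁ p | inj₂ q | _      = case inj (trans p (≡-sym q)) of λ ()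
  ... | inj₂ p | _      | inj₁ r = case inj (trans p (≡-sym r)) of λ ()
  ... | inj₂ p | _      | inj₂ r = case inj (trans p (≡-sym r)) of λ ()

module StarForest {n} {G : Graph n} (S : Sub G) (isStar : IsStarForest (sadj S)) where

  E : Fin n → Fin n → Bool
  E = sadj S

  E-sym : ∀ {u v} → T (E u v) → T (E v u)
  E-sym {u} {v} = subst T (ssym S u v)

  E⇒≢ : ∀ {u v} → T (E u v) → u ≢ v
  E⇒≢ {u} {v} = adj⇒≢ G ∘ inG S u v

  Other : Fin n → Fin n → Fin n → Set
  Other u v w = T (E u w) × w ≢ v

  other? : ∀ u v → Dec (∃ λ w → Other u v w)
  other? u v = Finₚ.any? λ w → T? (E u w) ×-dec ¬? (w Fin.≟ v)

  Leaf : Fin n → Fin n → Set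
  Leaf u v = T (E u v) × ¬ ∃ λ w → Other u v w

  Leaf? : ∀ u v → Dec (Leaf u v)
  Leaf? u v = T? (E u v) ×-dec ¬? (other? u v)

  Leaf-unique : ∀ {u v w} → Leaf u v → T (E u w) → w ≡ v
  Leaf-unique {v = v} {w} (_ , ¬other) uw = decidable-stable (w Fin.≟ v) λ w≢v → ¬other (w , uw , w≢v)

  -- If both ends had a further neighbour, equal neighbours would give a triangle and distinct ones
  -- a path with three edges.
  Leaf-total : ∀ u v → T (E u v) → Leaf u v ⊎ Leaf v u
  Leaf-total u v uv with other? u v | other? v u
  ... | no ¬p | _     = inj₁ (uv , ¬p)
  ... | yes _ | no ¬q = inj₂ (E-sym uv , ¬q)
  ... | yes (w , uw , w≢v) | yes (x , vx , x≢u) with w Fin.≟ x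
  ...   | yes refl = ⊥-elim (proj₁ isStar (triangle (E⇒≢ uv) (E⇒≢ vx) (E⇒≢ uw) uv vx (E-sym uw)))
  ...   | no w≢x   = ⊥-elim (proj₂ isStar (w , u , v , x , E⇒≢ (E-sym uw) , w≢v , w≢x , E⇒≢ uv ,
                       (λ u≡x → x≢u (≡-sym u≡x)) , E⇒≢ vx , E-sym uw , uv , vx))

  -- Edges point from leaf to centre; a single-edge component points from the smaller vertex.
  ToCentre : Fin n → Fin n → Set
  ToCentre u v = Leaf u v × ¬ (Leaf v u × v Fin.< u)

  ToCentre? : ∀ u v → Dec (ToCentre u v)
  ToCentre? u v = Leaf? u v ×-dec ¬? (Leaf? v u ×-dec v Finₚ.<? u)

  toCentre : Fin n → Fin n → Bool
  toCentre u v = does (ToCentre? u v)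

  toCentre-leaf : ∀ {u v} → T (toCentre u v) → Leaf u v
  toCentre-leaf {u} {v} = proj₁ ∘ dec⁻ (ToCentre? u v)

  ToCentre-total : ∀ u v → T (E u v) → ToCentre u v ⊎ ToCentre v u
  ToCentre-total u v uv with Leaf? u v | Leaf? v u
  ... | yes l | no ¬l = inj₁ (l , ¬l ∘ proj₁)
  ... | no ¬l | yes l = inj₂ (l , ¬l ∘ proj₁)
  ... | no ¬l | no ¬m = ⊥-elim ([ ¬l , ¬m ]′ (Leaf-total u v uv))
  ... | yes l | yes m with Finₚ.<-cmp u v
  ...   | tri< _ _ ¬> = inj₁ (l , ¬> ∘ proj₂)
  ...   | tri≈ _ e _  = ⊥-elim (E⇒≢ uv e)
  ...   | tri> ¬< _ _ = inj₂ (m , ¬< ∘ proj₂)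

  orients : Orients E toCentre
  orients = record
    { o⊆E        = λ u v → proj₁ ∘ toCentre-leaf
    ; o-total    = λ u v uv → [ inj₁ ∘ dec⁺ (ToCentre? u v) , inj₂ ∘ dec⁺ (ToCentre? v u) ]′
                               (ToCentre-total u v uv)
    ; o-asym     = λ u v p q → asym (dec⁻ (ToCentre? u v) p) (dec⁻ (ToCentre? v u) q)
    ; functional = λ u v w p q → ≡-sym (Leaf-unique (toCentre-leaf p) (proj₁ (toCentre-leaf q)))
    }
    where
    asym : ∀ {u v} → ToCentre u v → ¬ ToCentre v u
    asym {u} {v} (l , ¬p) (m , ¬q) with Finₚ.<-cmp u v
    ... | tri< u<v _ _ = ¬q (l , u<v)
    ... | tri≈ _ e _   = E⇒≢ (proj₁ l) e
    ... | tri> _ _ v<u = ¬p (m , v<u)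

-- Edges plus one are bounded only when there is an edge; an empty `f` contributes zero to both
-- sides.
countF+𝟙≤ : ∀ {n} (f : Fin n → Bool) k → (∀ e → T (f e) → suc (countF f) ≤ k) →
  countF f + 𝟙 (anyF f) ≤ 𝟙 (anyF f) * k
countF+𝟙≤ f k h with anyF f in eq
... | true  = subst₂ _≤_ (ℕₚ.+-comm 1 _) (≡-sym (ℕₚ.+-identityʳ k))
                (let e , p = anyF⁻ f (subst T (≡-sym eq) tt) in h e p)
... | false = subst (_≤ 0) (≡-sym (ℕₚ.+-identityʳ _))
                (ℕₚ.≮⇒≥ λ 1≤ → let e , p = countF-witness f 1≤ in subst T eq (anyF⁺ f e p))

module FromStars {n k : ℕ} {G : Graph n} (s : ℕ) (S : Fin k → Sub G)
  (isStar : ∀ i → IsStarForest (sadj (S i))) (cov : Covers G S)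
  (local : ∀ v → countF (λ i → vert (S i) v) ≤ s) where

  module St i = StarForest (S i) (isStar i)
  open Combine {G = G} S cov St.toCentre St.orients public

  outdeg≤s : ∀ v → outdeg orientation v ≤ s
  outdeg≤s v = ℕₚ.≤-trans (outdeg≤vert v) (local v)

  outdeg≡s⇒deg≡s : ∀ v → outdeg orientation v ≡ s → deg G v ≡ s
  outdeg≡s⇒deg≡s u eq = trans (ℕₚ.≤-antisym
      (countF-mono (adj G u) (out orientation u) all-out)
      (countF-mono (out orientation u) (adj G u) (outInG orientation u))) eq
    where
    all-out : ∀ w → T (adj G u w) → T (out orientation u w)
    all-out w a = subst (T ∘ out orientation u) (≡-sym w≡v) p
      where
      i = idx u w a
      -- The labels of the out-edges at `u` are distinct, and at most `s` star forests contain `u`.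
      -- With `s` out-edges every one of these forests is a label, in particular the one holding
      -- `uw`; since `u` is a leaf there, `w` is the head of the out-edge.
      hit = countF-onto (out orientation u) (λ i → vert (S i) u) (label u) (label-vert u) (label-injective u)
        (ℕₚ.≤-trans (local u) (ℕₚ.≤-reflexive (≡-sym eq))) i (anyF⁺ (sadj (S i) u) w (idx-covers u w a))
      v = proj₁ hit
      p = proj₁ (proj₂ hit)
      w≡v : w ≡ v
      w≡v = St.Leaf-unique i
              (St.toCentre-leaf i (subst (λ i → T (St.toCentre i u v)) (proj₂ (proj₂ hit)) (label-out u v p)))
              (idx-covers u w a)

  open Enumerate (out orientation)

  lab : Fin (length edges) → Fin k
  lab e = label (src e) (tgt e) (sound e)

  lab-leaf : ∀ e → St.Leaf (lab e) (src e) (tgt e)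
  lab-leaf e = St.toCentre-leaf (lab e) (label-out (src e) (tgt e) (sound e))

  src-injective : ∀ e e′ → lab e ≡ lab e′ → src e ≡ src e′ → e ≡ e′
  src-injective e e′ p q = ends-injective e e′ q (≡-sym (St.Leaf-unique (lab e) (lab-leaf e)
    (subst₂ (λ i u → T (sadj (S i) u (tgt e′))) (≡-sym p) (≡-sym q) (proj₁ (lab-leaf e′)))))

  -- Otherwise the leaf `src e` would have both `tgt e` and `src e′` as neighbours in one star
  -- forest. These would coincide, making `e′` the reverse of `e`.
  src≢tgt : ∀ e e′ → lab e ≡ lab e′ → src e ≢ tgt e′
  src≢tgt e e′ p q = antisym orientation (src e) (tgt e) (sound e)
    (subst₂ (λ u v → T (out orientation u v)) src′≡tgt (≡-sym q) (sound e′))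
    where
    src′≡tgt : src e′ ≡ tgt e
    src′≡tgt = St.Leaf-unique (lab e) (lab-leaf e)
      (subst (λ u → T (sadj (S (lab e)) u (src e′))) (≡-sym q)
        (St.E-sym (lab e) (subst (λ i → T (sadj (S i) (src e′) (tgt e′))) (≡-sym p) (proj₁ (lab-leaf e′)))))

  -- A star forest with an edge inside U has at most min(|V(Sᵢ) ∩ U|, |U|) − 1 of them. Add up
  -- the first bound if at least s of the star forests have an edge inside U, else the second.
  sparse : Sparse src tgt s
  sparse U u₀ p₀ = [ few , many ]′ (ℕₚ.≤-total M s)
    where
    I = inside src tgt U
    q : Fin k → Fin (length edges) → Bool
    q i e = does (lab e Fin.≟ i) ∧ I e
    t : Fin k → Fin n → Bool
    t i u = vert (S i) u ∧ U u
    Q = sum (λ i → countF (q i))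
    M = sum (λ i → 𝟙 (anyF (q i)))

    lab≡ : ∀ i e → T (q i e) → lab e ≡ i
    lab≡ i e p = dec⁻ (lab e Fin.≟ i) (proj₁ (and⁻ p))

    I≤Q : countF I ≤ Q
    I≤Q = countF-cover I q λ e p → lab e , and⁺ (dec⁺ (lab e Fin.≟ lab e) refl) p

    -- Send each edge to its tail. The tails are distinct vertices of `S i` in `U`, and the head of
    -- `e` is one more, since no tail is a head in the same star forest.
    q<t : ∀ i e → T (q i e) → suc (countF (q i)) ≤ countF (t i)
    q<t i e p = subst (suc (countF (q i)) ≤_) (≡-sym (countF-remove (t i) (tgt e) t-tgt))
      (s≤s (countF-inj (q i) (t i ∖ᵇ tgt e) (λ e′ _ → src e′) into
        λ e₁ e₂ p₁ p₂ → src-injective e₁ e₂ (trans (lab≡ i e₁ p₁) (≡-sym (lab≡ i e₂ p₂)))))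
      where
      leaf : ∀ e′ → T (q i e′) → T (sadj (S i) (src e′) (tgt e′))
      leaf e′ p′ = subst (λ i → T (sadj (S i) (src e′) (tgt e′))) (lab≡ i e′ p′) (proj₁ (lab-leaf e′))
      ends∈U : ∀ e′ → T (q i e′) → T (U (src e′)) × T (U (tgt e′))
      ends∈U e′ p′ = and⁻ (proj₂ (and⁻ {does (lab e′ Fin.≟ i)} p′))
      t-tgt : T (t i (tgt e))
      t-tgt = and⁺ (anyF⁺ (sadj (S i) (tgt e)) (src e) (St.E-sym i (leaf e p))) (proj₂ (ends∈U e p))
      into : ∀ e′ → T (q i e′) → T ((t i ∖ᵇ tgt e) (src e′))
      into e′ p′ = and⁺ (and⁺ (anyF⁺ (sadj (S i) (src e′)) (tgt e′) (leaf e′ p′)) (proj₁ (ends∈U e′ p′)))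
        (notDec⁺ (src e′ Fin.≟ tgt e) (src≢tgt e′ e (trans (lab≡ i e′ p′) (≡-sym (lab≡ i e p)))))

    𝟙*≤ : ∀ b {j} → 𝟙 b * j ≤ j
    𝟙*≤ true  = ℕₚ.≤-reflexive (ℕₚ.+-identityʳ _)
    𝟙*≤ false = z≤n

    Q+M : Q + M ≡ sum (λ i → countF (q i) + 𝟙 (anyF (q i)))
    Q+M = ≡-sym (∑-distrib-+ (λ i → countF (q i)) _)

    t-local : ∀ u → countF (λ i → t i u) ≤ 𝟙 (U u) * s
    t-local u with T? (U u)
    ... | yes p = ℕₚ.≤-trans (countF-mono (λ i → t i u) (λ i → vert (S i) u) (λ i → proj₁ ∘ and⁻))
                    (ℕₚ.≤-trans (local u) (ℕₚ.≤-trans (ℕₚ.≤-reflexive (≡-sym (ℕₚ.+-identityʳ s)))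
                      (ℕₚ.*-monoˡ-≤ s (𝟙≥1 (U u) p))))
      where
      𝟙≥1 : ∀ b → T b → 1 ≤ 𝟙 b
      𝟙≥1 true _ = s≤s z≤n
    ... | no ¬p = ℕₚ.≤-trans (ℕₚ.≮⇒≥ λ 1≤ →
                    let i , p = countF-witness (λ i → t i u) 1≤ in ¬p (proj₂ (and⁻ {vert (S i) u} p))) z≤n

    Q+M≤s*U : Q + M ≤ s * countF U
    Q+M≤s*U = begin
      Q + M                                               ≡⟨ Q+M ⟩
      sum (λ i → countF (q i) + 𝟙 (anyF (q i)))           ≤⟨ sum-mono (λ i → ℕₚ.≤-trans
                                                               (countF+𝟙≤ (q i) _ (q<t i)) (𝟙*≤ (anyF (q i)))) ⟩
      sum (λ i → countF (t i))                            ≡⟨ sum-countF-swap t ⟩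
      sum (λ u → countF (λ i → t i u))                    ≤⟨ sum-mono t-local ⟩
      sum (λ u → 𝟙 (U u) * s)                             ≡⟨ sum-*ʳ (𝟙 ∘ U) s ⟩
      sum (𝟙 ∘ U) * s                                     ≡⟨ cong (_* s) (countF≡sum U) ⟨
      countF U * s                                        ≡⟨ ℕₚ.*-comm (countF U) s ⟩
      s * countF U                                        ∎
      where open ℕₚ.≤-Reasoning

    Q+M≤M*U : Q + M ≤ M * countF U
    Q+M≤M*U = begin
      Q + M                                               ≡⟨ Q+M ⟩
      sum (λ i → countF (q i) + 𝟙 (anyF (q i)))           ≤⟨ sum-mono (λ i → countF+𝟙≤ (q i) _ λ e p → ℕₚ.≤-trans
                                                               (q<t i e p)
                                                               (countF-mono (t i) U (λ u → proj₂ ∘ and⁻ {vert (S i) u}))) ⟩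
      sum (λ i → 𝟙 (anyF (q i)) * countF U)               ≡⟨ sum-*ʳ (λ i → 𝟙 (anyF (q i))) (countF U) ⟩
      M * countF U                                        ∎
      where open ℕₚ.≤-Reasoning

    many : s ≤ M → countF I + s ≤ s * countF U
    many s≤M = ℕₚ.≤-trans (ℕₚ.+-mono-≤ I≤Q s≤M) Q+M≤s*U

    -- The deficit `d = s ∸ M` is absorbed by `d ≤ d * countF U`, which holds because `u₀` lies in
    -- `U`.
    few : M ≤ s → countF I + s ≤ s * countF U
    few M≤s = begin
      countF I + s                          ≤⟨ ℕₚ.+-monoˡ-≤ s I≤Q ⟩
      Q + s                                 ≡⟨ cong (Q +_) (ℕₚ.m+[n∸m]≡n M≤s) ⟨
      Q + (M + d)                           ≡⟨ ℕₚ.+-assoc Q M d ⟨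
      Q + M + d                             ≤⟨ ℕₚ.+-mono-≤ Q+M≤M*U (ℕₚ.m≤m*n d (countF U)) ⟩
      M * countF U + d * countF U           ≡⟨ ℕₚ.*-distribʳ-+ (countF U) M d ⟨
      (M + d) * countF U                    ≡⟨ cong (_* countF U) (ℕₚ.m+[n∸m]≡n M≤s) ⟩
      s * countF U                          ∎
      where
      open ℕₚ.≤-Reasoning
      d = s ∸ M
      instance
        U≢0 : NonZero (countF U)
        U≢0 = >-nonZero (countF≥1 U u₀ p₀)

  forestCover : ¬ ¬ CoverBy IsForest G s
  forestCover k = ForestPartition.forests src tgt s sparse λ (c , acyclic) → k
    ( (λ i → record
        { sadj = λ u v → does (hit? c i u v)
        ; ssym = λ u v → does-⇔ (mk⇔ (flip-hit c i) (flip-hit c i)) (hit? c i u v) (hit? c i v u)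
        ; inG  = λ u v p → case dec⁻ (hit? c i u v) p of λ where
            (e , _ , inj₁ (refl , refl)) → outInG orientation (src e) (tgt e) (sound e)
            (e , _ , inj₂ (refl , refl)) → adj-sym G (outInG orientation (src e) (tgt e) (sound e))
        })
    , (λ i → cycle-free src tgt (acyclic i) λ u v → dec⁻ (hit? c i u v))
    , λ u v a → case total orientation u v a of λ where
        (inj₁ p) → let e , q = complete u v p in c e , dec⁺ (hit? c _ u v) (e , refl , inj₁ q)
        (inj₂ p) → let e , q = complete v u p in c e , dec⁺ (hit? c _ u v) (e , refl , inj₂ q) )
    where
    Hit : (Fin (length edges) → Fin s) → Fin s → Fin n → Fin n → Set
    Hit c i u v = ∃ λ e → c e ≡ i × Joins e u v
    flip-hit : ∀ c i {u v} → Hit c i u v → Hit c i v u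
    flip-hit c i (e , p , j) = e , p , Joins-sym j
    hit? : ∀ c i u v → Dec (Hit c i u v)
    hit? c i u v = Finₚ.any? λ e → c e Fin.≟ i ×-dec Joins? e u v

LocalStarCover⇒forests : ∀ {n} {G : Graph n} {s} → LocalStarCover G s → ¬ ¬ CoverBy IsForest G s
LocalStarCover⇒forests {s = s} (k , S , isStar , cov , local) = FromStars.forestCover s S isStar cov local

-- Star covers from orientations

module InStars {n} {G : Graph n} (o : Orientation G) where

  Edge : Fin n → Fin n → Fin n → Set
  Edge w u v = (T (out o u w) × v ≡ w) ⊎ (T (out o v w) × u ≡ w)

  Edge? : ∀ w u v → Dec (Edge w u v)
  Edge? w u v = (T? (out o u w) ×-dec v Fin.≟ w) ⊎-dec (T? (out o v w) ×-dec u Fin.≟ w)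

  Edge-sym : ∀ {w u v} → Edge w u v → Edge w v u
  Edge-sym = [ inj₂ , inj₁ ]′

  inStar : Fin n → Sub G
  inStar w = record
    { sadj = λ u v → does (Edge? w u v)
    ; ssym = λ u v → does-⇔ (mk⇔ Edge-sym Edge-sym) (Edge? w u v) (Edge? w v u)
    ; inG  = λ u v p → case dec⁻ (Edge? w u v) p of λ where
        (inj₁ (q , refl)) → outInG o u w q
        (inj₂ (q , refl)) → adj-sym G (outInG o v w q)
    }

  vert-inStar : ∀ {w v} → T (vert (inStar w) v) → T (out o v w) ⊎ (w ≡ v × ∃ λ u → T (out o u v))
  vert-inStar {w} {v} p with anyF⁻ (sadj (inStar w) v) p
  ... | x , q with dec⁻ (Edge? w v x) q
  ...   | inj₁ (r , _)    = inj₁ r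
  ...   | inj₂ (r , refl) = inj₂ (refl , x , r)

  stars-at : ∀ v → countF (λ w → vert (inStar w) v) ≤ suc (outdeg o v)
  stars-at v with T? (vert (inStar v) v)
  ... | yes p = subst (_≤ suc (outdeg o v)) (≡-sym (countF-remove (λ w → vert (inStar w) v) v p))
                  (s≤s (countF-mono _ (out o v) λ w q → let q₁ , q₂ = and⁻ q in
                    [ id , ⊥-elim ∘ notDec⁻ (w Fin.≟ v) q₂ ∘ proj₁ ]′ (vert-inStar q₁)))
  ... | no ¬p = ℕₚ.m≤n⇒m≤1+n (countF-mono _ (out o v) λ w q →
                    [ id , (λ { (refl , _) → ⊥-elim (¬p q) }) ]′ (vert-inStar q))

  stars-at-source : ∀ v → deg G v ≤ outdeg o v → countF (λ w → vert (inStar w) v) ≤ outdeg o v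
  stars-at-source v deg≤ = countF-mono _ (out o v) λ w q →
    [ id , (λ { (_ , u , p) → ⊥-elim (no-in u p) }) ]′ (vert-inStar q)
    where
    no-in : ∀ u → ¬ T (out o u v)
    -- The out-neighbours are at least as many as the neighbours, so an in-neighbour `u` would be an
    -- out-neighbour too.
    no-in u p with countF-onto (out o v) (adj G v) (λ w _ → w) (outInG o v) (λ _ _ _ _ e → e) deg≤
                     u (adj-sym G (outInG o u v p))
    ... | _ , q , refl = antisym o u v p q

  -- One hypothesis serves both bounds: for `t = p + 1` every vertex takes the first alternative,
  -- and for `t = p` the vertices of out-degree `p` take the second.
  starCover : ∀ t → (∀ v → outdeg o v < t ⊎ (outdeg o v ≤ t × deg G v ≤ outdeg o v)) → LocalStarCover G t
  starCover t h = n , inStar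
    , (λ w → star w λ u v → [ inj₂ ∘ proj₂ , inj₁ ∘ proj₂ ]′ ∘ dec⁻ (Edge? w u v))
    , (λ u v a → [ (λ p → v , dec⁺ (Edge? v u v) (inj₁ (p , refl)))
                 , (λ p → u , dec⁺ (Edge? u u v) (inj₂ (p , refl))) ]′ (total o u v a))
    , λ v → [ ℕₚ.≤-trans (stars-at v)
            , (λ (≤t , deg≤) → ℕₚ.≤-trans (stars-at-source v deg≤) ≤t) ]′ (h v)

-- Pseudoforests from orientations

CycleEdge-sym : ∀ {n} {E : Fin n → Fin n → Bool} (C : Cycle E) {u v} → CycleEdge C u v → CycleEdge C v u
CycleEdge-sym C (inj₁ (i , inj₁ p)) = inj₁ (i , inj₂ p)
CycleEdge-sym C (inj₁ (i , inj₂ p)) = inj₁ (i , inj₁ p)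
CycleEdge-sym C (inj₂ (inj₁ p))     = inj₂ (inj₂ p)
CycleEdge-sym C (inj₂ (inj₂ p))     = inj₂ (inj₁ p)

module Functional {n} {E o : Fin n → Fin n → Bool} (orients : Orients E o) where
  open Orients orients

  Flow : Fin n → Fin n → Set
  Flow = Star λ u v → T (o u v)

  On : Cycle E → Fin n → Set
  On C u = ∃ λ i → vtx C i ≡ u

  Forward Backward : Cycle E → Set
  Forward  C = (∀ i → T (o (vtx C (inject₁ i)) (vtx C (suc i)))) × T (o (vtx C (fromℕ (len C))) (vtx C zero))
  Backward C = (∀ i → T (o (vtx C (suc i)) (vtx C (inject₁ i)))) × T (o (vtx C zero) (vtx C (fromℕ (len C))))

  -- An out-edge along the cycle forces the other cycle edge at its tail to point in. The direction
  -- of the first step thus propagates against the arrows: up the indices if it points back,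
  -- otherwise through the closing edge and down.
  directed : ∀ C → Forward C ⊎ Backward C
  directed record { len = suc zero ; len≥2 = s≤s () }
  directed record { len = suc (suc l) ; vtx = v ; inj = inj ; step = step ; close = close }
    with o-total _ _ (step zero)
  ... | inj₂ back₀ = inj₂ (back , back-close)
    where
    back : ∀ i → T (o (v (suc i)) (v (inject₁ i)))
    back = <-weakInduction _ back₀ λ i b →
      [ (λ f → case Finₚ.toℕ-injective (cong toℕ (inj (functional _ _ _ b f))) of λ e →
          ⊥-elim (ℕₚ.<⇒≢ (ℕₚ.m<n⇒m<1+n ℕₚ.≤-refl)
            (trans (≡-sym (trans (Finₚ.toℕ-inject₁ _) (Finₚ.toℕ-inject₁ i))) (cong toℕ e))))
      , id ]′ (o-total _ _ (step (suc i)))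
    back-close : T (o (v zero) (v (fromℕ _)))
    back-close = [ (λ f → case inj (functional _ _ _ (back (fromℕ _)) f) of λ ()) , id ]′ (o-total _ _ close)
  ... | inj₁ fwd₀ = inj₁ (fwd , fwd-close)
    where
    fwd-close : T (o (v (fromℕ _)) (v zero))
    fwd-close = [ id , (λ b → case inj (functional _ _ _ fwd₀ b) of λ ()) ]′ (o-total _ _ close)
    fwd : ∀ i → T (o (v (inject₁ i)) (v (suc i)))
    fwd = >-weakInduction _
      ([ id , (λ b → case inj (functional _ _ _ fwd-close b) of λ ()) ]′ (o-total _ _ (step (fromℕ _))))
      λ i f → [ id
              , (λ b → case inj (functional _ _ _ f b) of λ e →
                  ⊥-elim (ℕₚ.<⇒≢ (ℕₚ.m<n⇒m<1+n ℕₚ.≤-refl)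
                    (≡-sym (trans (cong toℕ e) (trans (Finₚ.toℕ-inject₁ _) (Finₚ.toℕ-inject₁ i)))))) ]′
              (o-total _ _ (step (inject₁ i)))

  Successor : Cycle E → Fin n → Set
  Successor C u = ∃ λ v → T (o u v) × On C v × CycleEdge C u v

  successor : ∀ C u → On C u → Successor C u
  successor C _ (i , refl) with directed C
  ... | inj₁ (fwd , fwd-close) = go i
    where
    go : ∀ i → Successor C (vtx C i)
    go = >-weakInduction _
      (_ , fwd-close , (zero , refl) , inj₂ (inj₁ (refl , refl)))
      λ i _ → _ , fwd i , (suc i , refl) , inj₁ (i , inj₁ (refl , refl))
  ... | inj₂ (back , back-close) = go i
    where
    go : ∀ i → Successor C (vtx C i)
    go zero    = _ , back-close , (fromℕ _ , refl) , inj₂ (inj₂ (refl , refl))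
    go (suc i) = _ , back i , (inject₁ i , refl) , inj₁ (i , inj₂ (refl , refl))

  cycle-flow : ∀ C {u v} → On C u → On C v → Flow u v
  cycle-flow C (i , refl) (j , refl) with directed C
  ... | inj₁ (fwd , fwd-close) = to-end i ◅◅ fwd-close ◅ from-start j
    where
    from-start : ∀ j → Flow (vtx C zero) (vtx C j)
    from-start = <-weakInduction _ ε λ i r → r ◅◅ fwd i ◅ ε
    to-end : ∀ i → Flow (vtx C i) (vtx C (fromℕ _))
    to-end = >-weakInduction _ ε λ i r → fwd i ◅ r
  ... | inj₂ (back , back-close) = to-start i ◅◅ back-close ◅ from-end j
    where
    to-start : ∀ i → Flow (vtx C i) (vtx C zero)
    to-start = <-weakInduction _ ε λ i r → back i ◅ r
    from-end : ∀ j → Flow (vtx C (fromℕ _)) (vtx C j)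
    from-end = >-weakInduction _ ε λ i r → r ◅◅ back i ◅ ε

  -- The successor on the cycle is the only out-neighbour, so following arrows never leaves the
  -- cycle.
  closed : ∀ C {u v} → On C u → Flow u v → On C v
  closed C on ε = on
  closed C {u} on (p ◅ r) with successor C u on
  ... | w , q , on′ , _ with refl ← functional _ _ _ p q = closed C on′ r

  FlowsInto : Cycle E → Fin n → Set
  FlowsInto C u = ∃ λ c → On C c × Flow u c

  -- An edge entering `u` prolongs the flow at its start. An edge leaving `u` is the first arrow of
  -- the flow or, if `u` is already on `C`, stays on `C`.
  FlowsInto-reach : ∀ C {u w} → FlowsInto C u → Reach E u w → FlowsInto C w
  FlowsInto-reach C into here = into
  FlowsInto-reach C {u} (c , on , f) (next {v = v} uv r) = FlowsInto-reach C (move f (o-total _ _ uv)) r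
    where
    move : Flow u c → T (o u v) ⊎ T (o v u) → FlowsInto C v
    move f       (inj₂ q) = c , on , q ◅ f
    move ε       (inj₁ p) = v , closed C on (p ◅ ε) , ε
    move (q ◅ f) (inj₁ p) with refl ← functional _ _ _ p q = c , on , f

  CycleEdge-on : ∀ C {u v} → CycleEdge C u v → On C u × On C v × (T (E u v) ⊎ T (E v u))
  CycleEdge-on C (inj₁ (i , inj₁ (refl , refl))) = (_ , refl) , (_ , refl) , inj₁ (step C i)
  CycleEdge-on C (inj₁ (i , inj₂ (refl , refl))) = (_ , refl) , (_ , refl) , inj₂ (step C i)
  CycleEdge-on C (inj₂ (inj₁ (refl , refl)))     = (_ , refl) , (_ , refl) , inj₁ (close C)
  CycleEdge-on C (inj₂ (inj₂ (refl , refl)))     = (_ , refl) , (_ , refl) , inj₂ (close C)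

  CycleEdge-transfer : ∀ C D → (∀ u → On C u → On D u) → ∀ u v → CycleEdge C u v → CycleEdge D u v
  CycleEdge-transfer C D C⊆D u v c with CycleEdge-on C c
  ... | on-u , on-v , e = [ along , CycleEdge-sym D ∘ along′ ]′ ([ o-total u v , Sum.swap ∘ o-total v u ]′ e)
    where
    along : T (o u v) → CycleEdge D u v
    along p with successor D u (C⊆D u on-u)
    ... | _ , q , _ , d with refl ← functional _ _ _ p q = d
    along′ : T (o v u) → CycleEdge D v u
    along′ p with successor D v (C⊆D v on-v)
    ... | _ , q , _ , d with refl ← functional _ _ _ p q = d

  -- The base vertex of `D` flows to a vertex `c` of `C`, and `c` lies on `D` as well because flow
  -- does not leave `D`. All of either cycle is reached from `c`, so the vertices agree; unique
  -- successors make the edges agree.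
  pseudoforest : IsPseudoforest E
  pseudoforest C D r u v with FlowsInto-reach C (_ , (zero , refl) , ε) r
  ... | c , onC , f = CycleEdge-transfer C D (λ w onw → closed D onD (cycle-flow C onC onw)) u v
                    , CycleEdge-transfer D C (λ w onw → closed C onC (cycle-flow D onD onw)) u v
    where onD = closed D (zero , refl) f

-- Number the out-edges of each vertex by increasing head; each number spans a pseudoforest.
module Ranked {n} {G : Graph n} (o : Orientation G) where

  earlier : Fin n → Fin n → Fin n → Bool
  earlier u v w = out o u w ∧ does (w Finₚ.<? v)

  rank : Fin n → Fin n → ℕ
  rank u v = countF (earlier u v)

  rank-mono : ∀ u v w → T (out o u v) → v Fin.< w → rank u v < rank u w
  rank-mono u v w p v<w = subst (suc (rank u v) ≤_)
    (≡-sym (countF-remove (earlier u w) v (and⁺ p (dec⁺ (v Finₚ.<? w) v<w))))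
    (s≤s (countF-mono (earlier u v) (earlier u w ∖ᵇ v) λ x q → let q₁ , q₂ = and⁻ q ; x<v = dec⁻ (x Finₚ.<? v) q₂ in
      and⁺ (and⁺ q₁ (dec⁺ (x Finₚ.<? w) (Finₚ.<-trans x<v v<w))) (notDec⁺ (x Fin.≟ v) (Finₚ.<⇒≢ x<v))))

  rank-injective : ∀ u v w → T (out o u v) → T (out o u w) → rank u v ≡ rank u w → v ≡ w
  rank-injective u v w p q eq with Finₚ.<-cmp v w
  ... | tri< v<w _ _ = ⊥-elim (ℕₚ.<⇒≢ (rank-mono u v w p v<w) eq)
  ... | tri≈ _ v≡w _ = v≡w
  ... | tri> _ _ w<v = ⊥-elim (ℕₚ.<⇒≢ (rank-mono u w v q w<v) (≡-sym eq))

  rank<outdeg : ∀ u v → T (out o u v) → rank u v < outdeg o u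
  rank<outdeg u v p = subst (suc (rank u v) ≤_) (≡-sym (countF-remove (out o u) v p))
    (s≤s (countF-mono (earlier u v) (out o u ∖ᵇ v) λ x q → let q₁ , q₂ = and⁻ q in
      and⁺ q₁ (notDec⁺ (x Fin.≟ v) (Finₚ.<⇒≢ (dec⁻ (x Finₚ.<? v) q₂)))))

  Out : ∀ {k} → Fin k → Fin n → Fin n → Set
  Out i u v = T (out o u v) × rank u v ≡ toℕ i

  Out? : ∀ {k} (i : Fin k) u v → Dec (Out i u v)
  Out? i u v = T? (out o u v) ×-dec rank u v ℕₚ.≟ toℕ i

  Edge? : ∀ {k} (i : Fin k) u v → Dec (Out i u v ⊎ Out i v u)
  Edge? i u v = Out? i u v ⊎-dec Out? i v u

  layer : ∀ {k} → Fin k → Sub G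
  layer i = record
    { sadj = λ u v → does (Edge? i u v)
    ; ssym = λ u v → does-⇔ (mk⇔ Sum.swap Sum.swap) (Edge? i u v) (Edge? i v u)
    ; inG  = λ u v p → [ outInG o u v ∘ proj₁ , adj-sym G ∘ outInG o v u ∘ proj₁ ]′ (dec⁻ (Edge? i u v) p)
    }

  orients : ∀ {k} (i : Fin k) → Orients (sadj (layer i)) (λ u v → does (Out? i u v))
  orients i = record
    { o⊆E        = λ u v → dec⁺ (Edge? i u v) ∘ inj₁ ∘ dec⁻ (Out? i u v)
    ; o-total    = λ u v → Sum.map (dec⁺ (Out? i u v)) (dec⁺ (Out? i v u)) ∘ dec⁻ (Edge? i u v)
    ; o-asym     = λ u v p q → antisym o u v (proj₁ (dec⁻ (Out? i u v) p)) (proj₁ (dec⁻ (Out? i v u) q))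
    ; functional = λ u v w p q → let p₁ , p₂ = dec⁻ (Out? i u v) p ; q₁ , q₂ = dec⁻ (Out? i u w) q in
                     rank-injective u v w p₁ q₁ (trans p₂ (≡-sym q₂))
    }

  pseudoforestCover : ∀ k → (∀ v → outdeg o v ≤ k) → CoverBy IsPseudoforest G k
  pseudoforestCover k ≤k = layer , (λ i → Functional.pseudoforest (orients i)) , λ u v a →
    [ (λ p → in-layer p , dec⁺ (Edge? _ u v) (inj₁ (p , rank-in-layer p)))
    , (λ p → in-layer p , dec⁺ (Edge? _ u v) (inj₂ (p , rank-in-layer p))) ]′ (total o u v a)
    where
    in-layer : ∀ {u v} → T (out o u v) → Fin k
    in-layer {u} {v} p = Fin.fromℕ< (ℕₚ.≤-trans (rank<outdeg u v p) (≤k u))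
    rank-in-layer : ∀ {u v} (p : T (out o u v)) → rank u v ≡ toℕ (in-layer p)
    rank-in-layer {u} {v} p = ≡-sym (Finₚ.toℕ-fromℕ< (ℕₚ.≤-trans (rank<outdeg u v p) (≤k u)))

-- Orientations from pseudoforests

module Paths {n m : ℕ} (src tgt : Fin m → Fin n) where
  open Edges src tgt

  data Path (P : EdgeSet) : Fin n → Fin n → ℕ → Set where
    nil  : ∀ {a} → Path P a a 0
    cons : ∀ {a b c l e} → P e → Joins e a b → Path P b c l → Path P a c (suc l)

  vertex : ∀ {P a b l} → Path P a b l → Fin (suc l) → Fin n
  vertex {a = a} _           zero    = a
  vertex         (cons _ _ p) (suc i) = vertex p i

  vertex-last : ∀ {P a b l} (p : Path P a b l) → vertex p (fromℕ l) ≡ b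
  vertex-last nil          = refl
  vertex-last (cons _ _ p) = vertex-last p

  vertex-step : ∀ {P a b l} (p : Path P a b l) i → ∃ λ e → P e × Joins e (vertex p (inject₁ i)) (vertex p (suc i))
  vertex-step (cons q j p) zero    = _ , q , j
  vertex-step (cons _ _ p) (suc i) = vertex-step p i

  Simple : ∀ {P a b l} → Path P a b l → Set
  Simple p = ∀ i j → vertex p i ≡ vertex p j → i ≡ j

  SimplePath : EdgeSet → Fin n → Fin n → Set
  SimplePath P a b = ∃ λ l → Σ (Path P a b l) Simple

  suffix : ∀ {P a b l} (p : Path P a b l) → Simple p → ∀ i → SimplePath P (vertex p i) b
  suffix p           sp zero    = _ , p , sp
  suffix (cons _ _ p) sp (suc i) = suffix p (λ i j e → Finₚ.suc-injective (sp _ _ e)) i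

  simplePath : ∀ {P a b} → Conn P a b → SimplePath P a b
  simplePath ε = 0 , nil , λ { zero zero _ → refl }
  simplePath {P} {a} {b} (via e q j r) with simplePath r
  ... | l , p , sp with Finₚ.any? (λ i → vertex p i Fin.≟ a)
  ...   | yes (i , at-a) = subst (λ u → SimplePath P u b) at-a (suffix p sp i)
  ...   | no ¬at-a = suc l , (cons q j p) , λ where
          zero    zero    _  → refl
          zero    (suc k) eq → ⊥-elim (¬at-a (k , ≡-sym eq))
          (suc i) zero    eq → ⊥-elim (¬at-a (i , eq))
          (suc i) (suc k) eq → cong suc (sp i k eq)

  spanningForest : ∀ L → ∃ λ (F : Fin m → Bool) →
    Acyclic (T ∘ F) × (∀ x → x ∈ L → ¬ T (F x) → Conn (T ∘ F) (src x) (tgt x))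
  spanningForest [] = (λ _ → false) , (λ _ ()) , λ _ ()
  spanningForest (z ∷ L) with spanningForest L
  ... | F , acF , span with Conn? (T? ∘ F) (src z) (tgt z)
  ...   | yes zz = F , acF , λ { x (Any.here refl) _ → zz ; x (Any.there x∈) → span x x∈ }
  ...   | no ¬zz = F⁺ , Acyclic-insert z F⁺⁻ acF ¬zz , λ where
            x (Any.here refl) ¬F⁺ → ⊥-elim (¬F⁺ (dec⁺ (x Fin.≟ x ⊎-dec T? (F x)) (inj₁ refl)))
            x (Any.there x∈)  ¬F⁺ → Conn-mono (λ e → F⊆F⁺ e) (span x x∈ (¬F⁺ ∘ F⊆F⁺ x))
    where
    F⁺ : Fin m → Bool
    F⁺ e = does (e Fin.≟ z ⊎-dec T? (F e))
    F⁺⁻ : ∀ e → T (F⁺ e) → e ≡ z ⊎ T (F e)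
    F⁺⁻ e = dec⁻ (e Fin.≟ z ⊎-dec T? (F e))
    F⊆F⁺ : ∀ e → T (F e) → T (F⁺ e)
    F⊆F⁺ e = dec⁺ (e Fin.≟ z ⊎-dec T? (F e)) ∘ inj₂

least : ∀ {n} {P : Fin n → Set} → (∀ i → Dec (P i)) → ∀ i → P i → ∃ λ r → P r × (∀ v → P v → r Fin.≤ v)
least {n} {P} P? i = go i (<-wellFounded i)
  where
  go : ∀ i → Acc Fin._<_ i → P i → ∃ λ r → P r × (∀ v → P v → r Fin.≤ v)
  go i (acc rs) p with Finₚ.any? (λ v → P? v ×-dec v Finₚ.<? i)
  ... | yes (v , q , v<i) = go v (rs v<i) q
  ... | no ¬smaller       = i , p , λ v q → ℕₚ.≮⇒≥ λ v<i → ¬smaller (v , q , v<i)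

-- Let F be a maximal acyclic set of edges. A component of F contains at most one edge outside F,
-- since two would close different cycles. Orient F towards a root of each component, chosen to be
-- an end of the edge outside F if there is one; that edge leaves the root.
module Pseudoforest {n} {G : Graph n} (S : Sub G) (pseudo : IsPseudoforest (sadj S)) where

  E : Fin n → Fin n → Bool
  E = sadj S

  E-sym : ∀ {u v} → T (E u v) → T (E v u)
  E-sym {u} {v} = subst T (ssym S u v)

  open Enumerate (λ u v → E u v ∧ does (u Finₚ.<? v))
  open Paths src tgt

  src<tgt : ∀ e → src e Fin.< tgt e
  src<tgt e = dec⁻ (src e Finₚ.<? tgt e) (proj₂ (and⁻ {E (src e) (tgt e)} (sound e)))

  Joins⇒E : ∀ {e u v} → Joins e u v → T (E u v)
  Joins⇒E {e} (inj₁ (refl , refl)) = proj₁ (and⁻ (sound e))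
  Joins⇒E {e} (inj₂ (refl , refl)) = E-sym (proj₁ (and⁻ (sound e)))

  E⇒Joins : ∀ u v → T (E u v) → ∃ λ e → Joins e u v
  E⇒Joins u v uv with Finₚ.<-cmp u v
  ... | tri< u<v _ _ = let e , p = complete u v (and⁺ uv (dec⁺ (u Finₚ.<? v) u<v)) in e , inj₁ p
  ... | tri≈ _ u≡v _ = ⊥-elim (adj⇒≢ G (inG S u v uv) u≡v)
  ... | tri> _ _ v<u = let e , p = complete v u (and⁺ (E-sym uv) (dec⁺ (v Finₚ.<? u) v<u)) in e , inj₂ p

  Joins-unique : ∀ {e e′ u v} → Joins e u v → Joins e′ u v → e ≡ e′
  Joins-unique {e} {e′} (inj₁ (refl , refl)) (inj₁ (p , q)) = ends-injective e e′ (≡-sym p) (≡-sym q)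
  Joins-unique {e} {e′} (inj₂ (refl , refl)) (inj₂ (p , q)) = ends-injective e e′ (≡-sym p) (≡-sym q)
  Joins-unique {e} {e′} (inj₁ (refl , refl)) (inj₂ (p , q)) =
    ⊥-elim (Finₚ.<-asym (src<tgt e) (subst₂ Fin._<_ p q (src<tgt e′)))
  Joins-unique {e} {e′} (inj₂ (refl , refl)) (inj₁ (p , q)) =
    ⊥-elim (Finₚ.<-asym (src<tgt e) (subst₂ Fin._<_ p q (src<tgt e′)))

  abstract
    spanning : ∃ λ (F : Fin (length edges) → Bool) →
      Acyclic (T ∘ F) × (∀ x → ¬ T (F x) → Conn (T ∘ F) (src x) (tgt x))
    spanning = let F , acF , span = spanningForest (List.allFin _) in F , acF , λ x → span x (∈ₚ.∈-allFin x)

  F : EdgeSet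
  F = T ∘ proj₁ spanning

  F? : ∀ e → Dec (F e)
  F? = T? ∘ proj₁ spanning

  acyclic : Acyclic F
  acyclic = proj₁ (proj₂ spanning)

  spans : ∀ x → ¬ F x → Conn F (src x) (tgt x)
  spans = proj₂ (proj₂ spanning)

  module _ (x : Fin (length edges)) (¬Fx : ¬ F x) where

    fundamentalPath : SimplePath F (src x) (tgt x)
    fundamentalPath = simplePath (spans x ¬Fx)

    private
      p = proj₁ (proj₂ fundamentalPath)

    -- Length 0 would make `x` a loop, and length 1 would put `x` itself into `F`.
    long : ∀ {l a b} → Path F a b l → src x ≡ a → tgt x ≡ b → 2 ≤ l
    long nil                     refl q    = ⊥-elim (Finₚ.<⇒≢ (src<tgt x) (≡-sym q))
    long (cons f j nil)          refl refl = ⊥-elim (¬Fx (subst F (Joins-unique j (inj₁ (refl , refl))) f))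
    long (cons _ _ (cons _ _ _)) _    _    = s≤s (s≤s z≤n)

    fundamentalCycle : Cycle E
    fundamentalCycle = record
      { len   = proj₁ fundamentalPath
      ; len≥2 = long p refl refl
      ; vtx   = vertex p
      ; inj   = proj₂ (proj₂ fundamentalPath) _ _
      ; step  = λ i → Joins⇒E (proj₂ (proj₂ (vertex-step p i)))
      ; close = subst (λ u → T (E u (src x))) (≡-sym (vertex-last p)) (Joins⇒E (inj₂ (refl , refl)))
      }

    fundamental-∋ : CycleEdge fundamentalCycle (src x) (tgt x)
    fundamental-∋ = inj₂ (inj₂ (vertex-last p , refl))

    fundamental-edges : ∀ {u v} → CycleEdge fundamentalCycle u v → ∃ λ e → (F e ⊎ e ≡ x) × Joins e u v
    fundamental-edges (inj₁ (i , inj₁ (refl , refl))) =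
      let e , f , j = vertex-step p i in e , inj₁ f , j
    fundamental-edges (inj₁ (i , inj₂ (refl , refl))) =
      let e , f , j = vertex-step p i in e , inj₁ f , Joins-sym j
    fundamental-edges (inj₂ (inj₁ (q , refl))) = x , inj₂ refl , inj₂ (refl , trans (≡-sym (vertex-last p)) q)
    fundamental-edges (inj₂ (inj₂ (q , refl))) = x , inj₂ refl , inj₁ (refl , trans (≡-sym (vertex-last p)) q)

  Conn⇒Reach : ∀ {P u v} → Conn P u v → Reach E u v
  Conn⇒Reach ε             = here
  Conn⇒Reach (via e _ j r) = next (Joins⇒E j) (Conn⇒Reach r)

  -- The fundamental cycles of `x` and `x′` lie in one component, hence coincide; `x′` is the only
  -- edge outside `F` on its own, and `x` is on it.
  extra-unique : ∀ x x′ → ¬ F x → ¬ F x′ → Conn F (src x) (src x′) → x ≡ x′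
  extra-unique x x′ ¬Fx ¬Fx′ r
    with fundamental-edges x′ ¬Fx′ (proj₁ (pseudo (fundamentalCycle x ¬Fx) (fundamentalCycle x′ ¬Fx′)
           (Conn⇒Reach r) (src x) (tgt x)) (fundamental-∋ x ¬Fx))
  ... | e , inj₁ f    , j = ⊥-elim (¬Fx (subst F (Joins-unique j (inj₁ (refl , refl))) f))
  ... | e , inj₂ refl , j = Joins-unique (inj₁ (refl , refl)) j

  -- The minimum in the second alternative is only a canonical choice. It leaves one root per
  -- component, so that `root` takes the same value at both ends of an edge.
  Root : Fin n → Set
  Root r = (∃ λ x → ¬ F x × src x ≡ r)
         ⊎ ((∀ x → ¬ F x → ¬ Conn F r (src x)) × (∀ v → Conn F r v → r Fin.≤ v))

  Root-unique : ∀ {r r′} → Root r → Root r′ → Conn F r r′ → r ≡ r′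
  Root-unique (inj₁ (x , ¬Fx , refl)) (inj₁ (x′ , ¬Fx′ , refl)) c = cong src (extra-unique x x′ ¬Fx ¬Fx′ c)
  Root-unique (inj₁ (x , ¬Fx , refl)) (inj₂ (none , _)) c = ⊥-elim (none x ¬Fx (Conn-sym c))
  Root-unique (inj₂ (none , _)) (inj₁ (x , ¬Fx , refl)) c = ⊥-elim (none x ¬Fx c)
  Root-unique (inj₂ (_ , min)) (inj₂ (_ , min′)) c = Finₚ.≤-antisym (min _ c) (min′ _ (Conn-sym c))

  abstract
    findRoot : ∀ u → ∃ λ r → Root r × Conn F u r
    findRoot u with Finₚ.any? (λ x → ¬? (F? x) ×-dec Conn? F? u (src x))
    ... | yes (x , ¬Fx , c) = src x , inj₁ (x , ¬Fx , refl) , c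
    ... | no none with least (Conn? F? u) u ε
    ...   | r , c , min = r , inj₂ ((λ x ¬Fx c′ → none (x , ¬Fx , Conn-trans c c′))
                                , λ v c′ → min v (Conn-trans c c′)) , c

  root : Fin n → Fin n
  root = proj₁ ∘ findRoot

  root-Root : ∀ u → Root (root u)
  root-Root = proj₁ ∘ proj₂ ∘ findRoot

  root-conn : ∀ u → Conn F u (root u)
  root-conn = proj₂ ∘ proj₂ ∘ findRoot

  root-cong : ∀ {u v} → Conn F u v → root u ≡ root v
  root-cong {u} {v} c = Root-unique (root-Root u) (root-Root v)
    (Conn-trans (Conn-sym (root-conn u)) (Conn-trans c (root-conn v)))

  -- Removing a forest edge splits its component; the edge points to the side that still contains
  -- the root. An edge outside `F` leaves its `src`, which is the root.
  Out : Fin n → Fin n → Set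
  Out a b = (∃ λ e → F e × Joins e a b × Conn (F ∖ e) b (root b)) ⊎ (∃ λ x → ¬ F x × src x ≡ a × tgt x ≡ b)

  Out? : ∀ a b → Dec (Out a b)
  Out? a b = Finₚ.any? (λ e → F? e ×-dec Joins? e a b ×-dec Conn? (λ f → F? f ×-dec ¬? (f Fin.≟ e)) b (root b))
    ⊎-dec Finₚ.any? (λ x → ¬? (F? x) ×-dec src x Fin.≟ a ×-dec tgt x Fin.≟ b)

  weaken : ∀ {P : EdgeSet} {e u v} → Conn (P ∖ e) u v → Conn P u v
  weaken = Conn-mono λ _ → proj₁

  separates : ∀ {e a b} → F e → Joins e a b → ¬ Conn (F ∖ e) a b
  separates {e} f j = acyclic e f ∘ Conn-joins⁻ j

  Out⊆E : ∀ {a b} → Out a b → T (E a b)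
  Out⊆E (inj₁ (_ , _ , j , _))       = Joins⇒E j
  Out⊆E (inj₂ (_ , _ , refl , refl)) = Joins⇒E (inj₁ (refl , refl))

  Out-total : ∀ a b → T (E a b) → Out a b ⊎ Out b a
  Out-total a b ab with E⇒Joins a b ab
  ... | e , j with F? e | j
  ...   | no ¬f | inj₁ (p , q) = inj₁ (inj₂ (e , ¬f , p , q))
  ...   | no ¬f | inj₂ (p , q) = inj₂ (inj₂ (e , ¬f , p , q))
  -- Follow the walk from `b` to the root. If it needs `e`, the part after the passage starts at `a`
  -- or `b` and avoids `e`, which shows the side of the root.
  ...   | yes f | _ with Conn-split {Q = F ∖ e} e keep (root-conn b)
    where
    keep : ∀ e′ → F e′ → e′ ≡ e ⊎ (F ∖ e) e′
    keep e′ f′ with e′ Fin.≟ e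
    ... | yes e′≡e = inj₁ e′≡e
    ... | no  e′≢e = inj₂ (f′ , e′≢e)
  ...     | inj₁ c = inj₁ (inj₁ (e , f , j , c))
  ...     | inj₂ (x , y , k , _ , c) with Joins-ends j k
  ...       | inj₁ (refl , refl) = inj₁ (inj₁ (e , f , j , c))
  ...       | inj₂ (refl , refl) = inj₂ (inj₁ (e , f , Joins-sym j ,
                subst (Conn (F ∖ e) a) (root-cong (Conn-edge e f (Joins-sym j))) c))

  -- If both ends of a forest edge reached the common root without it, it would not be a bridge. Two
  -- edges outside `F` cannot be opposite, as each runs from its smaller end.
  Out-asym : ∀ {a b} → Out a b → ¬ Out b a
  Out-asym (inj₁ (e , f , j , c)) (inj₁ (e′ , f′ , j′ , c′)) with refl ← Joins-unique j (Joins-sym j′) =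
    separates f j (Conn-trans c′ (subst (λ r → Conn (F ∖ e) r _)
      (root-cong (Conn-edge e f (Joins-sym j))) (Conn-sym c)))
  Out-asym (inj₁ (e , f , j , _)) (inj₂ (x , ¬f , p , q)) = ¬f (subst F (Joins-unique j (inj₂ (p , q))) f)
  Out-asym (inj₂ (x , ¬f , p , q)) (inj₁ (e , f , j , _)) = ¬f (subst F (Joins-unique j (inj₂ (p , q))) f)
  Out-asym (inj₂ (x , _ , p , q)) (inj₂ (x′ , _ , p′ , q′)) =
    Finₚ.<-asym (src<tgt x) (subst₂ Fin._<_ (trans p′ (≡-sym q)) (trans q′ (≡-sym p)) (src<tgt x′))

  -- No edge of `F` leaves a root: if `b` reached the root `a` without `e`, the edge `e` would not
  -- be a bridge.
  Out-extra : ∀ {a b e x} → F e → Joins e a b → ¬ Conn (F ∖ e) b (root b) ⊎ ¬ (¬ F x × src x ≡ a)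
  Out-extra {a} {b} {e} {x} f j with F? x | src x Fin.≟ a
  ... | yes f′ | _      = inj₂ λ (¬f , _) → ¬f f′
  ... | no _   | no s≢a = inj₂ (s≢a ∘ proj₂)
  ... | no ¬f  | yes s≡a = inj₁ λ c → separates f j (Conn-sym (subst (Conn (F ∖ e) b) root≡a c))
    where
    root≡a : root b ≡ a
    root≡a = trans (root-cong (Conn-edge e f (Joins-sym j)))
      (Root-unique (root-Root a) (inj₁ (x , ¬f , s≡a)) (Conn-sym (root-conn a)))

  meet : ∀ {a b b′ e e′ u} → F e → Joins e a b → F e′ → Joins e′ a b′ → Conn (F ∖ e) b (root b) →
    Conn ((F ∖ e′) ∖ e) u (root b′) → Conn (F ∖ e) u b
  meet {b = b} {e = e} f j f′ j′ c r = Conn-trans (Conn-mono (λ _ ((g , _) , ne) → g , ne) r)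
    (subst (λ r → Conn (F ∖ e) r b)
      (root-cong (Conn-trans (Conn-edge e f (Joins-sym j)) (Conn-edge _ f′ j′))) (Conn-sym c))

  Out-functional : ∀ {a b b′} → Out a b → Out a b′ → b ≡ b′
  Out-functional (inj₂ (x , ¬f , refl , refl)) (inj₂ (x′ , ¬f′ , p′ , refl)) =
    cong tgt (extra-unique x x′ ¬f ¬f′ (subst (Conn F (src x)) (≡-sym p′) ε))
  Out-functional (inj₁ (e , f , j , c)) (inj₂ (x , ¬f , p , _)) =
    ⊥-elim ([ (λ ¬c → ¬c c) , (λ ¬x → ¬x (¬f , p)) ]′ (Out-extra {x = x} f j))
  Out-functional (inj₂ (x , ¬f , p , _)) (inj₁ (e , f , j , c)) =
    ⊥-elim ([ (λ ¬c → ¬c c) , (λ ¬x → ¬x (¬f , p)) ]′ (Out-extra {x = x} f j))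
  Out-functional {a} {b} {b′} (inj₁ (e , f , j , c)) (inj₁ (e′ , f′ , j′ , c′)) with e Fin.≟ e′
  ... | yes refl = [ proj₂ , (λ (p , q) → trans q p) ]′ (Joins-ends j j′)
  -- Two forest edges leaving `a` would give two routes to the root. If the route from `b′` avoids
  -- `e`, or crosses it from `b` to `a`, the ends of `e` are connected without `e`; if it crosses
  -- from `a` to `b`, its beginning connects the ends of `e′` without `e′`.
  ... | no e≢e′ with Conn-split {Q = (F ∖ e′) ∖ e} e keep c′
    where
    keep : ∀ d → (F ∖ e′) d → d ≡ e ⊎ ((F ∖ e′) ∖ e) d
    keep d q with d Fin.≟ e
    ... | yes d≡e = inj₁ d≡e
    ... | no  d≢e = inj₂ (q , d≢e)
  ...   | inj₁ r = ⊥-elim (separates f j (Conn-trans (Conn-edge e′ (f′ , e≢e′ ∘ ≡-sym) j′) (meet f j f′ j′ c r)))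
  ...   | inj₂ (x , y , k , r₁ , r₂) with Joins-ends j k
  ...     | inj₁ (refl , refl) = ⊥-elim (separates f′ j′ (Conn-sym (weaken r₁)))
  ...     | inj₂ (refl , refl) = ⊥-elim (separates f j (meet f j f′ j′ c r₂))

  orients : Orients E (λ u v → does (Out? u v))
  orients = record
    { o⊆E        = λ u v → Out⊆E ∘ dec⁻ (Out? u v)
    ; o-total    = λ u v → Sum.map (dec⁺ (Out? u v)) (dec⁺ (Out? v u)) ∘ Out-total u v
    ; o-asym     = λ u v p q → Out-asym (dec⁻ (Out? u v) p) (dec⁻ (Out? v u) q)
    ; functional = λ u v w p q → Out-functional (dec⁻ (Out? u v) p) (dec⁻ (Out? u w) q)
    }

pseudoforestCover⇒orientation : ∀ {n} {G : Graph n} {k} → CoverBy IsPseudoforest G k →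
  Σ (Orientation G) λ o → ∀ v → outdeg o v ≤ k
pseudoforestCover⇒orientation {G = G} {k} (H , pseudo , cov) =
  orientation , λ v → ℕₚ.≤-trans (outdeg≤vert v) (countF≤n _)
  where
  module P i = Pseudoforest (H i) (pseudo i)
  open Combine {G = G} H cov _ P.orients

-- The inequalities and the criterion for equality

forests⇒pseudoforests : ∀ {n} {G : Graph n} {k} → CoverBy IsForest G k → CoverBy IsPseudoforest G k
forests⇒pseudoforests (H , forest , cov) = H , (λ i C _ → ⊥-elim (forest i C)) , cov

inequalities : ∀ {n} {G : Graph n} {p a s} →
  IsPseudoarboricity G p → IsArboricity G a → IsLocalStarArboricity G s → p ≤ a × a ≤ s × s ≤ p + 1
inequalities {p = p} {a} {s} (pCov , pMin) (aCov , aMin) (sCov , sMin) =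
    pMin a (forests⇒pseudoforests aCov)
  , decidable-stable (a ℕₚ.≤? s) (λ a≰s → LocalStarCover⇒forests sCov (a≰s ∘ aMin s))
  , (let o , ≤p = pseudoforestCover⇒orientation pCov in
     sMin (p + 1) (InStars.starCover o (p + 1) λ v →
       inj₁ (subst (outdeg o v <_) (ℕₚ.+-comm 1 p) (s≤s (≤p v)))))

equality : ∀ {n} {G : Graph n} {p s} → IsPseudoarboricity G p → IsLocalStarArboricity G s →
  s ≡ p ⇔ Σ (Orientation G) λ o → MaxOutdegIs o p × (∀ v → outdeg o v ≡ p → deg G v ≡ p)
equality {n} {G} {p} {s} (_ , pMin) ((k , S , isStar , cov , local) , sMin) = mk⇔ to from
  where
  Good : ℕ → Set
  Good t = Σ (Orientation G) λ o → MaxOutdegIs o t × (∀ v → outdeg o v ≡ t → deg G v ≡ t)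

  open FromStars {G = G} s S isStar cov local

  -- If the bound were not attained, numbering the out-edges would produce a cover by fewer
  -- pseudoforests than the minimum.
  attained : ∀ t → (∀ v → outdeg orientation v ≤ t) → (∀ k → CoverBy IsPseudoforest G k → t ≤ k) →
    t ≡ 0 ⊎ Σ (Fin n) λ v → outdeg orientation v ≡ t
  attained zero    _  _   = inj₁ refl
  attained (suc t) ≤t min with Finₚ.any? (λ v → outdeg orientation v ℕₚ.≟ suc t)
  ... | yes found = inj₂ found
  ... | no none   = ⊥-elim (ℕₚ.1+n≰n (min t (Ranked.pseudoforestCover orientation t
                      λ v → ℕₚ.≤-pred (ℕₚ.≤∧≢⇒< (≤t v) λ eq → none (v , eq)))))

  to : s ≡ p → Good p
  to s≡p = subst Good s≡p (orientation
    , (outdeg≤s , attained s outdeg≤s (λ k c → subst (_≤ k) (≡-sym s≡p) (pMin k c)))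
    , outdeg≡s⇒deg≡s)

  from : Good p → s ≡ p
  from (o , (≤p , _) , source) = ℕₚ.≤-antisym
    (sMin p (InStars.starCover o p bound))
    (decidable-stable (p ℕₚ.≤? s) λ p≰s → forestCover (p≰s ∘ pMin s ∘ forests⇒pseudoforests))
    where
    bound : ∀ v → outdeg o v < p ⊎ (outdeg o v ≤ p × deg G v ≤ outdeg o v)
    bound v with outdeg o v ℕₚ.≟ p
    ... | yes eq = inj₂ (≤p v , ℕₚ.≤-reflexive (trans (source v eq) (≡-sym eq)))
    ... | no ne  = inj₁ (ℕₚ.≤∧≢⇒< (≤p v) ne)

-- Strictness: the triangle, the path with three edges, and the empty graph

edge⇒k≥1 : ∀ {n} {G : Graph n} P {k} u v → T (adj G u v) → CoverBy P G k → 1 ≤ k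
edge⇒k≥1 P {suc _} u v a _ = s≤s z≤n
edge⇒k≥1 P {zero}  u v a (_ , _ , cov) = case proj₁ (cov u v a) of λ ()

module Triangle where

  K₃ : Graph 3
  K₃ = record
    { adj    = E
    ; sym    = from-yes (Finₚ.all? λ u → Finₚ.all? λ v → E u v Boolₚ.≟ E v u)
    ; irrefl = from-yes (Finₚ.all? λ v → E v v Boolₚ.≟ false)
    }
    where
    E : Fin 3 → Fin 3 → Bool
    E u v = not (does (u Fin.≟ v))

  rotate : Fin 3 → Fin 3
  rotate zero             = suc zero
  rotate (suc zero)       = suc (suc zero)
  rotate (suc (suc zero)) = zero

  cyclic : Orientation K₃
  cyclic = record
    { out     = o
    ; outInG  = from-yes (Finₚ.all? λ u → Finₚ.all? λ v → T? (o u v) →-dec T? (adj K₃ u v))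
    ; total   = from-yes (Finₚ.all? λ u → Finₚ.all? λ v → T? (adj K₃ u v) →-dec (T? (o u v) ⊎-dec T? (o v u)))
    ; antisym = from-yes (Finₚ.all? λ u → Finₚ.all? λ v → T? (o u v) →-dec ¬? (T? (o v u)))
    }
    where
    o : Fin 3 → Fin 3 → Bool
    o u v = does (v Fin.≟ rotate u)

  pseudoarboricity : IsPseudoarboricity K₃ 1
  pseudoarboricity = Ranked.pseudoforestCover cyclic 1 (from-yes (Finₚ.all? λ v → outdeg cyclic v ℕₚ.≤? 1))
    , λ k → edge⇒k≥1 IsPseudoforest zero (suc zero) tt

  starAt : Fin 3 → Fin 3 → Fin 3 → Bool
  starAt w u v = adj K₃ u v ∧ does (u Fin.≟ w ⊎-dec v Fin.≟ w)

  stars : Fin 2 → Sub K₃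
  stars i = record
    { sadj = starAt (inject₁ i)
    ; ssym = from-yes (Finₚ.all? λ w → Finₚ.all? λ u → Finₚ.all? λ v → starAt w u v Boolₚ.≟ starAt w v u) (inject₁ i)
    ; inG  = λ u v → proj₁ ∘ and⁻
    }

  arboricity : IsArboricity K₃ 2
  arboricity =
    ( stars
    , (λ i → proj₁ (star (inject₁ i) λ u v p →
        dec⁻ (u Fin.≟ inject₁ i ⊎-dec v Fin.≟ inject₁ i) (proj₂ (and⁻ {adj K₃ u v} p))))
    , from-yes (Finₚ.all? λ u → Finₚ.all? λ v → T? (adj K₃ u v) →-dec
        Finₚ.any? λ i → T? (starAt (inject₁ i) u v)) )
    , lower
    where
    lower : ∀ k → CoverBy IsForest K₃ k → 2 ≤ k
    lower zero          cover = ⊥-elim (ℕₚ.1+n≰n (edge⇒k≥1 IsForest zero (suc zero) tt cover))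
    lower (suc (suc k)) _     = s≤s (s≤s z≤n)
    lower (suc zero) (H , forest , cov) = ⊥-elim (forest zero
      (triangle {a = zero} {suc zero} {suc (suc zero)} (λ ()) (λ ()) (λ ())
        (all-in-H₀ zero (suc zero) tt) (all-in-H₀ (suc zero) (suc (suc zero)) tt)
        (all-in-H₀ (suc (suc zero)) zero tt)))
      where
      all-in-H₀ : ∀ u v → T (adj K₃ u v) → T (sadj (H zero) u v)
      all-in-H₀ u v a with zero , p ← cov u v a = p

module FourPath where

  o : Fin 4 → Fin 4 → Bool
  o u v = does (toℕ u ℕₚ.≟ suc (toℕ v))

  P₄ : Graph 4
  P₄ = record
    { adj    = E
    ; sym    = from-yes (Finₚ.all? λ u → Finₚ.all? λ v → E u v Boolₚ.≟ E v u)
    ; irrefl = from-yes (Finₚ.all? λ v → E v v Boolₚ.≟ false)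
    }
    where
    E : Fin 4 → Fin 4 → Bool
    E u v = o u v ∨ o v u

  orients : Orients (adj P₄) o
  orients = record
    { o⊆E        = from-yes (Finₚ.all? λ u → Finₚ.all? λ v → T? (o u v) →-dec T? (adj P₄ u v))
    ; o-total    = from-yes (Finₚ.all? λ u → Finₚ.all? λ v → T? (adj P₄ u v) →-dec (T? (o u v) ⊎-dec T? (o v u)))
    ; o-asym     = from-yes (Finₚ.all? λ u → Finₚ.all? λ v → T? (o u v) →-dec ¬? (T? (o v u)))
    ; functional = from-yes (Finₚ.all? λ u → Finₚ.all? λ v → Finₚ.all? λ w →
                     T? (o u v) →-dec (T? (o u w) →-dec v Fin.≟ w))
    }

  descending : Orientation P₄
  descending = record { out = o ; outInG = o⊆E ; total = o-total ; antisym = o-asym }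
    where open Orients orients

  open Functional orients

  Flow⇒≥ : ∀ {u v} → Flow u v → v Fin.≤ u
  Flow⇒≥ ε       = ℕₚ.≤-refl
  Flow⇒≥ {u} (_◅_ {j = w} p r) =
    ℕₚ.≤-trans (Flow⇒≥ r) (ℕₚ.≤-trans (ℕₚ.n≤1+n _) (ℕₚ.≤-reflexive (≡-sym (dec⁻ (toℕ u ℕₚ.≟ suc (toℕ w)) p))))

  -- Arrows lower the index, while on a cycle the first and last vertices flow to each other and so
  -- would be equal.
  forest : IsForest (adj P₄)
  forest C with inj C (Finₚ.≤-antisym
      (Flow⇒≥ (cycle-flow C (fromℕ _ , refl) (zero , refl))) (Flow⇒≥ (cycle-flow C (zero , refl) (fromℕ _ , refl))))
  ... | 0≡last = ℕₚ.<⇒≢ (ℕₚ.<-trans (s≤s z≤n) (len≥2 C)) (trans (cong toℕ 0≡last) (Finₚ.toℕ-fromℕ _))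

  arboricity : IsArboricity P₄ 1
  arboricity =
    ( (λ _ → record { sadj = adj P₄ ; ssym = Graph.sym P₄ ; inG = λ _ _ → id })
    , (λ _ → forest) , λ _ _ a → zero , a )
    , λ k → edge⇒k≥1 IsForest zero (suc zero) tt

  localStarArboricity : IsLocalStarArboricity P₄ 2
  localStarArboricity =
    InStars.starCover descending 2 (λ v → inj₁ (from-yes (Finₚ.all? λ v → suc (outdeg descending v) ℕₚ.≤? 2) v))
    , λ t cover → ℕₚ.≮⇒≥ λ t<2 → lower (ℕₚ.≤-pred t<2) cover
    where
    lower : ∀ {t} → t ≤ 1 → ¬ LocalStarCover P₄ t
    lower t≤1 (k , S , isStar , cov , local) = proj₂ (isStar i) (x₀ , x₁ , x₂ , x₃ ,
        (λ ()) , (λ ()) , (λ ()) , (λ ()) , (λ ()) , (λ ()) , proj₂ (cov x₀ x₁ tt) , S₁₂ , S₂₃)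
      where
      x₀ x₁ x₂ x₃ : Fin 4
      x₀ = zero
      x₁ = suc zero
      x₂ = suc (suc zero)
      x₃ = suc (suc (suc zero))
      i = proj₁ (cov x₀ x₁ tt)
      -- Only one star forest contains `v`, so the one holding `uv` also holds `vw`. Hence all three
      -- edges of the path would lie in `S i`.
      extend : ∀ u v w → T (sadj (S i) u v) → T (adj P₄ v w) → T (sadj (S i) v w)
      extend u v w uv vw = let j , p = cov v w vw in subst (λ l → T (sadj (S l) v w))
        (countF≤1⇒unique (λ l → vert (S l) v) (ℕₚ.≤-trans (local v) t≤1) j i
          (anyF⁺ (sadj (S j) v) w p) (anyF⁺ (sadj (S i) v) u (subst T (ssym (S i) u v) uv))) p
      S₁₂ : T (sadj (S i) x₁ x₂)
      S₁₂ = extend x₀ x₁ x₂ (proj₂ (cov x₀ x₁ tt)) tt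
      S₂₃ : T (sadj (S i) x₂ x₃)
      S₂₃ = extend x₁ x₂ x₃ S₁₂ tt

module Empty where

  K₀ : Graph 0
  K₀ = record { adj = λ () ; sym = λ () ; irrefl = λ () }

  pseudoarboricity : IsPseudoarboricity K₀ 0
  pseudoarboricity = ((λ ()) , (λ ()) , λ ()) , λ _ _ → z≤n

  localStarArboricity : IsLocalStarArboricity K₀ 0
  localStarArboricity = (0 , (λ ()) , (λ ()) , (λ ()) , λ ()) , λ _ _ → z≤n

theorem9 :
  (∀ (n : ℕ) (G : Graph n) (p a s : ℕ) →
     IsPseudoarboricity G p → IsArboricity G a → IsLocalStarArboricity G s →
     p ≤ a × a ≤ s × s ≤ p + 1)
  ×
  ((Σ ℕ λ n → Σ (Graph n) λ G → Σ ℕ λ p → Σ ℕ λ a →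
      IsPseudoarboricity G p × IsArboricity G a × p < a)
   ×
   (Σ ℕ λ n → Σ (Graph n) λ G → Σ ℕ λ a → Σ ℕ λ s →
      IsArboricity G a × IsLocalStarArboricity G s × a < s)
   ×
   (Σ ℕ λ n → Σ (Graph n) λ G → Σ ℕ λ p → Σ ℕ λ s →
      IsPseudoarboricity G p × IsLocalStarArboricity G s × s < p + 1))
  ×
  (∀ (n : ℕ) (G : Graph n) (p s : ℕ) →
     IsPseudoarboricity G p → IsLocalStarArboricity G s →
     (s ≡ p ⇔ Σ (Orientation G) λ o →
                MaxOutdegIs o p × (∀ v → outdeg o v ≡ p → deg G v ≡ p)))
theorem9 =
    (λ _ _ _ _ _ → inequalities)
  , ( (3 , Triangle.K₃ , 1 , 2 , Triangle.pseudoarboricity , Triangle.arboricity , s≤s (s≤s z≤n))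
    , (4 , FourPath.P₄ , 1 , 2 , FourPath.arboricity , FourPath.localStarArboricity , s≤s (s≤s z≤n))
    , (0 , Empty.K₀ , 0 , 0 , Empty.pseudoarboricity , Empty.localStarArboricity , s≤s z≤n) )
  , (λ _ _ _ _ → equality)
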